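{- For any integer $\gamma \geq 0$, the operad $\mathsf{Dias}_\gamma$ admits the following presentation. It is generated by $\mathfrak{G}_\gamma := \{\dashv_a, \vdash_a : a \in [\gamma]\}$ (all generators being of arity $2$) and its space of relations is the space induced by the equivalence relation $\leftrightarrow_\gamma$ satisfying $$\dashv_a \circ_1 \vdash_{a'} \;\leftrightarrow_\gamma\; \vdash_{a'} \circ_2 \dashv_a, \qquad a, a' \in [\gamma],$$ $$\dashv_a \circ_1 \dashv_b \;\leftrightarrow_\gamma\; \dashv_a \circ_2 \vdash_b, \qquad a < b \in [\gamma],$$ $$\vdash_a \circ_1 \dashv_b \;\leftrightarrow_\gamma\; \vdash_a \circ_2 \vdash_b, \qquad a < b \in [\gamma],$$ $$\dashv_b \circ_1 \dashv_a \;\leftrightarrow_\gamma\; \dashv_a \circ_2 \dashv_b, \qquad a < b \in [\gamma],$$ $$\vdash_a \circ_1 \vdash_b \;\leftrightarrow_\gamma\; \vdash_b \circ_2 \vdash_a, \qquad a < b \in [\gamma],$$ $$\dashv_d \circ_1 \dashv_d \;\leftrightarrow_\gamma\; \dashv_d \circ_2 \dashv_c \;\leftrightarrow_\gamma\; \dashv_d \circ_2 \vdash_c, \qquad c \leq d \in [\gamma],$$ $$\vdash_d \circ_1 \dashv_c \;\leftrightarrow_\gamma\; \vdash_d \circ_1 \vdash_c \;\leftrightarrow_\gamma\; \vdash_d \circ_2 \vdash_d, \qquad c \leq d \in [\gamma].$$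
   Context: The ground field $\mathbb{K}$ has characteristic zero; $[\gamma] = \{1,\dots,\gamma\}$. Operads are nonsymmetric, described by partial compositions $\circ_i$ and a unit. For a monoid $(\mathcal{M}, \bullet, 1)$, $\mathsf{T}\mathcal{M}$ is the operad whose arity-$n$ component ($n \ge 1$) is the linear span of the words of length $n$ on $\mathcal{M}$, with $u \circ_i v := u_1 \dots u_{i-1}\,(u_i \bullet v_1) \dots (u_i \bullet v_m)\, u_{i+1} \dots u_n$ (for words $u,v$ of lengths $n,m$) and unit the one-letter word $1$. Let $\mathcal{M}_\gamma$ be the monoid on $\{0\} \cup [\gamma]$ with product $\max$. $\mathsf{Dias}_\gamma$ is the suboperad of $\mathsf{T}\mathcal{M}_\gamma$ generated by the words $0a$ and $a0$, $a \in [\gamma]$. $\mathbf{Free}(S)$ is the free nonsymmetric operad on a graded set $S$: its arity-$n$ component has as basis the planar rooted trees with $n$ leaves whose internal nodes of arity $k$ are labeled by elements of $S$ of arity $k$, and $\mathfrak{s} \circ_i \mathfrak{t}$ is the tree obtained by grafting the root of $\mathfrak{t}$ on the $i$th leaf of $\mathfrak{s}$. An element $x \in S$ is identified with the tree having a single internal node labeled by $x$, so $x \circ_i y$ is a tree with two internal nodes. A presentation of an operad $\mathcal{O}$ is a pair $(\mathfrak{G}, \mathfrak{R})$ with $\mathfrak{G}$ a graded set and $\mathfrak{R}$ a subspace of $\mathbf{Free}(\mathfrak{G})$ such that $\mathcal{O} \cong \mathbf{Free}(\mathfrak{G})/\langle\mathfrak{R}\rangle$, with $\langle \mathfrak{R}\rangle$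 the operad ideal generated by $\mathfrak{R}$. The space induced by an equivalence relation $\leftrightarrow$ on trees (of equal arity) is the linear span of all $x - x'$ with $x \leftrightarrow x'$. -}

module Defs where

open import Level using (Level; _⊔_; 0ℓ) renaming (suc to lsuc)
open import Algebra.Apartness.Bundles using (HeytingField; HeytingCommutativeRing)
open import Algebra.Bundles using (CommutativeMonoid; CommutativeRing)
open import Algebra.Module.Bundles using (Module)
open import Algebra.Module.Morphism.Structures using (module ModuleMorphisms)
open import Algebra.Module.Structures.Biased using (module IsModuleFromLeft)
open import Algebra.Structures using (IsMonoid)
import Algebra.Construct.NaturalChoice.Max as Max
import Algebra.Properties.CommutativeSemigroup as CommutativeSemigroupProperties
open import Data.Fin.Base as Fin using (Fin; zero; suc; toℕ)
import Data.Fin.Properties as Fin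
open import Data.List.Base as List using (List; []; _∷_)
import Data.List.Properties as List
open import Data.Nat.Base as ℕ using (ℕ; zero; suc; _+_; _∸_; _≤_; _<_; z≤n; s≤s)
open import Data.Nat.Properties
open import Data.Product.Base using (Σ; Σ-syntax; ∃-syntax; _×_; _,_; proj₁; proj₂)
open import Data.Vec.Base as Vec using (Vec; []; _∷_)
import Data.Vec.Properties as Vec
open import Relation.Binary.Construct.Closure.Equivalence using (EqClosure)
open import Relation.Binary.PropositionalEquality
  using (_≡_; refl; sym; trans; cong; cong₂; subst; module ≡-Reasoning)
open import Relation.Nullary using (¬_; yes; no; contradiction)

private
  variable
    a b g c ℓ₁ ℓ₂ : Level

swap-last : ∀ n m l → n + m + l ≡ n + l + m
swap-last = CommutativeSemigroupProperties.xy∙z≈xz∙y +-commutativeSemigroup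

-- Nonsymmetric operads in sets.  There is nothing in arity 0, so everything
-- graded by the arity is indexed by n : ℕ standing for arity n + 1.  Inputs are
-- numbered from 0, and composing arities n + 1 and m + 1 gives arity n + m + 1.

record SetOperad b : Set (lsuc b) where
  infixl 7 _∘[_]_
  field
    El     : ℕ → Set b
    unit   : El 0
    _∘[_]_ : ∀ {n m} → El n → Fin (suc n) → El m → El (n + m)

    identityˡ : ∀ {m} (y : El m) → unit ∘[ zero ] y ≡ y
    identityʳ : ∀ {n} (x : El n) i →
      subst El (+-identityʳ n) (x ∘[ i ] unit) ≡ x
    assoc-nested : ∀ {n m l} (x : El n) i (y : El m) j (z : El l) k →
      toℕ k ≡ toℕ i + toℕ j →
      subst El (+-assoc n m l) (x ∘[ i ] y ∘[ k ] z) ≡ x ∘[ i ] (y ∘[ j ] z)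
    assoc-parallel : ∀ {n m l} (x : El n) i (y : El m) j (z : El l) i′ j′ →
      toℕ i < toℕ j → toℕ i′ ≡ toℕ i → toℕ j′ ≡ toℕ j + m →
      subst El (swap-last n m l) (x ∘[ i ] y ∘[ j′ ] z) ≡ x ∘[ j ] z ∘[ i′ ] y

module Words {M : Set a} (_∙_ : M → M → M) where

  infixl 7 _∘[_]_

  _∘[_]_ : ∀ {n m} → Vec M (suc n) → Fin (suc n) → Vec M (suc m) → Vec M (suc (n + m))
  _∘[_]_ {n} {m} (x ∷ u) zero v =
    Vec.cast (cong suc (+-comm m n)) (Vec.map (x ∙_) v Vec.++ u)
  _∘[_]_ {suc n} (x ∷ u) (suc i) v = x ∷ (u ∘[ i ] v)

  insert : List M → ℕ → List M → List M
  insert []      _       v = []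
  insert (x ∷ u) zero    v = List.map (x ∙_) v List.++ u
  insert (x ∷ u) (suc i) v = x ∷ insert u i v

  toList-∘ : ∀ {n m} (u : Vec M (suc n)) i (v : Vec M (suc m)) →
    Vec.toList (u ∘[ i ] v) ≡ insert (Vec.toList u) (toℕ i) (Vec.toList v)
  toList-∘ {n} {m} (x ∷ u) zero v =
    trans (Vec.toList-cast (cong suc (+-comm m n)) (Vec.map (x ∙_) v Vec.++ u))
      (trans (Vec.toList-++ (Vec.map (x ∙_) v) u)
        (cong (List._++ Vec.toList u) (Vec.toList-map (x ∙_) v)))
  toList-∘ {suc n} (x ∷ u) (suc i) v = cong (x ∷_) (toList-∘ u i v)

  toList-subst : ∀ {n m} (e : n ≡ m) (u : Vec M (suc n)) →
    Vec.toList (subst (λ k → Vec M (suc k)) e u) ≡ Vec.toList u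
  toList-subst refl u = refl

  toList-inj : ∀ {n} (u v : Vec M n) → Vec.toList u ≡ Vec.toList v → u ≡ v
  toList-inj u v e =
    trans (sym (Vec.cast-is-id refl u)) (Vec.toList-injective refl u v e)

  length-toList : ∀ {n} (u : Vec M n) → List.length (Vec.toList u) ≡ n
  length-toList u = Vec.length-toList u

  module Laws {ε : M} (isMonoid : IsMonoid _≡_ _∙_ ε) where
    module M = IsMonoid isMonoid

    insert-map : ∀ x v j w u → j < List.length v →
      insert (List.map (x ∙_) v List.++ u) j w ≡
      List.map (x ∙_) (insert v j w) List.++ u
    insert-map x (y ∷ v) zero w u _ = begin
      List.map ((x ∙ y) ∙_) w List.++ (List.map (x ∙_) v List.++ u)
        ≡⟨ cong (List._++ _) (List.map-cong (M.assoc x y) w) ⟩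
      List.map (λ z → x ∙ (y ∙ z)) w List.++ (List.map (x ∙_) v List.++ u)
        ≡⟨ cong (List._++ _) (List.map-∘ w) ⟩
      List.map (x ∙_) (List.map (y ∙_) w) List.++ (List.map (x ∙_) v List.++ u)
        ≡⟨ List.++-assoc (List.map (x ∙_) (List.map (y ∙_) w)) _ u ⟨
      (List.map (x ∙_) (List.map (y ∙_) w) List.++ List.map (x ∙_) v) List.++ u
        ≡⟨ cong (List._++ u) (List.map-++ (x ∙_) (List.map (y ∙_) w) v) ⟨
      List.map (x ∙_) (List.map (y ∙_) w List.++ v) List.++ u ∎
      where open ≡-Reasoning
    insert-map x (y ∷ v) (suc j) w u (s≤s j<) = cong (_ ∷_) (insert-map x v j w u j<)

    insert-++ : ∀ p u j w →
      insert (p List.++ u) (List.length p + j) w ≡ p List.++ insert u j w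
    insert-++ []      u j w = refl
    insert-++ (x ∷ p) u j w = cong (x ∷_) (insert-++ p u j w)

    insert-unitʳ : ∀ u i → insert u i (ε ∷ []) ≡ u
    insert-unitʳ []      i       = refl
    insert-unitʳ (x ∷ u) zero    = cong (_∷ u) (M.identityʳ x)
    insert-unitʳ (x ∷ u) (suc i) = cong (x ∷_) (insert-unitʳ u i)

    insert-unitˡ : ∀ v → insert (ε ∷ []) 0 v ≡ v
    insert-unitˡ v = trans (List.++-identityʳ _)
      (trans (List.map-cong M.identityˡ v) (List.map-id v))

    insert-nested : ∀ u i v j w → j < List.length v →
      insert (insert u i v) (i + j) w ≡ insert u i (insert v j w)
    insert-nested []      i       v j w j< = refl
    insert-nested (x ∷ u) zero    v j w j< = insert-map x v j w u j<
    insert-nested (x ∷ u) (suc i) v j w j< = cong (x ∷_) (insert-nested u i v j w j<)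

    insert-parallel : ∀ u i v j w m → List.length v ≡ suc m → i < j →
      insert (insert u i v) (j + m) w ≡ insert (insert u j w) i v
    insert-parallel []      i       v j       w m e i<j = refl
    insert-parallel (x ∷ u) zero    v (suc j) w m e i<j = begin
      insert (List.map (x ∙_) v List.++ u) (suc j + m) w
        ≡⟨ cong (λ k → insert (List.map (x ∙_) v List.++ u) k w) lem ⟩
      insert (List.map (x ∙_) v List.++ u) (List.length (List.map (x ∙_) v) + j) w
        ≡⟨ insert-++ (List.map (x ∙_) v) u j w ⟩
      List.map (x ∙_) v List.++ insert u j w ∎
      where
      open ≡-Reasoning
      lem : suc j + m ≡ List.length (List.map (x ∙_) v) + j
      lem = trans (cong suc (+-comm j m))
              (cong (_+ j) (sym (trans (List.length-map (x ∙_) v) e)))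
    insert-parallel (x ∷ u) (suc i) v (suc j) w m e (s≤s i<j) =
      cong (x ∷_) (insert-parallel u i v j w m e i<j)

    identityˡ : ∀ {m} (v : Vec M (suc m)) → (ε ∷ []) ∘[ zero ] v ≡ v
    identityˡ v = toList-inj _ _
      (trans (toList-∘ (ε ∷ []) zero v) (insert-unitˡ (Vec.toList v)))

    identityʳ : ∀ {n} (u : Vec M (suc n)) i →
      subst (λ k → Vec M (suc k)) (+-identityʳ n) (u ∘[ i ] (ε ∷ [])) ≡ u
    identityʳ {n} u i = toList-inj _ _
      (trans (toList-subst (+-identityʳ n) _)
        (trans (toList-∘ u i (ε ∷ [])) (insert-unitʳ (Vec.toList u) (toℕ i))))

    assoc-nested : ∀ {n m l} (u : Vec M (suc n)) i (v : Vec M (suc m)) j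
      (w : Vec M (suc l)) k → toℕ k ≡ toℕ i + toℕ j →
      subst (λ k → Vec M (suc k)) (+-assoc n m l) (u ∘[ i ] v ∘[ k ] w) ≡
      u ∘[ i ] (v ∘[ j ] w)
    assoc-nested {n} {m} {l} u i v j w k e = toList-inj _ _ (begin
      Vec.toList (subst (λ k → Vec M (suc k)) (+-assoc n m l) (u ∘[ i ] v ∘[ k ] w))
        ≡⟨ toList-subst (+-assoc n m l) _ ⟩
      Vec.toList (u ∘[ i ] v ∘[ k ] w)
        ≡⟨ toList-∘ (u ∘[ i ] v) k w ⟩
      insert (Vec.toList (u ∘[ i ] v)) (toℕ k) (Vec.toList w)
        ≡⟨ cong₂ (λ p q → insert p q (Vec.toList w)) (toList-∘ u i v) e ⟩
      insert (insert (Vec.toList u) (toℕ i) (Vec.toList v)) (toℕ i + toℕ j) (Vec.toList w)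
        ≡⟨ insert-nested (Vec.toList u) (toℕ i) (Vec.toList v) (toℕ j) (Vec.toList w)
             (subst (toℕ j <_) (sym (length-toList v)) (Fin.toℕ<n j)) ⟩
      insert (Vec.toList u) (toℕ i) (insert (Vec.toList v) (toℕ j) (Vec.toList w))
        ≡⟨ cong (insert (Vec.toList u) (toℕ i)) (toList-∘ v j w) ⟨
      insert (Vec.toList u) (toℕ i) (Vec.toList (v ∘[ j ] w))
        ≡⟨ toList-∘ u i (v ∘[ j ] w) ⟨
      Vec.toList (u ∘[ i ] (v ∘[ j ] w)) ∎)
      where open ≡-Reasoning

    assoc-parallel : ∀ {n m l} (u : Vec M (suc n)) i (v : Vec M (suc m)) j
      (w : Vec M (suc l)) i′ j′ →
      toℕ i < toℕ j → toℕ i′ ≡ toℕ i → toℕ j′ ≡ toℕ j + m →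
      subst (λ k → Vec M (suc k)) (swap-last n m l) (u ∘[ i ] v ∘[ j′ ] w) ≡
      u ∘[ j ] w ∘[ i′ ] v
    assoc-parallel {n} {m} {l} u i v j w i′ j′ i<j e₁ e₂ = toList-inj _ _ (begin
      Vec.toList (subst (λ k → Vec M (suc k)) (swap-last n m l) (u ∘[ i ] v ∘[ j′ ] w))
        ≡⟨ toList-subst (swap-last n m l) _ ⟩
      Vec.toList (u ∘[ i ] v ∘[ j′ ] w)
        ≡⟨ toList-∘ (u ∘[ i ] v) j′ w ⟩
      insert (Vec.toList (u ∘[ i ] v)) (toℕ j′) (Vec.toList w)
        ≡⟨ cong₂ (λ p q → insert p q (Vec.toList w)) (toList-∘ u i v) e₂ ⟩
      insert (insert (Vec.toList u) (toℕ i) (Vec.toList v)) (toℕ j + m) (Vec.toList w)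
        ≡⟨ insert-parallel (Vec.toList u) (toℕ i) (Vec.toList v) (toℕ j) (Vec.toList w)
             m (length-toList v) i<j ⟩
      insert (insert (Vec.toList u) (toℕ j) (Vec.toList w)) (toℕ i) (Vec.toList v)
        ≡⟨ cong₂ (λ p q → insert p q (Vec.toList v)) (toList-∘ u j w) e₁ ⟨
      insert (Vec.toList (u ∘[ j ] w)) (toℕ i′) (Vec.toList v)
        ≡⟨ toList-∘ (u ∘[ j ] w) i′ v ⟨
      Vec.toList (u ∘[ j ] w ∘[ i′ ] v) ∎)
      where open ≡-Reasoning

wordOperad : {M : Set a} {_∙_ : M → M → M} {ε : M} → IsMonoid _≡_ _∙_ ε → SetOperad a
wordOperad {M = M} {_∙_} {ε} isMonoid = record
  { El     = λ n → Vec M (suc n)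
  ; unit   = ε ∷ []
  ; _∘[_]_ = Words._∘[_]_ _∙_
  ; identityˡ      = identityˡ
  ; identityʳ      = identityʳ
  ; assoc-nested   = assoc-nested
  ; assoc-parallel = assoc-parallel
  }
  where open Words.Laws _∙_ isMonoid

GradedSet : ∀ g → Set (lsuc g)
GradedSet g = ℕ → Set g

data Tree (G : GradedSet g) : Set g where
  leaf : Tree G
  node : ∀ {k} → G k → Vec (Tree G) (suc k) → Tree G

module Trees (G : GradedSet g) where

  mutual
    leaves : Tree G → ℕ
    leaves leaf        = 1
    leaves (node x ts) = leaves* ts

    leaves* : ∀ {k} → Vec (Tree G) k → ℕ
    leaves* []       = 0
    leaves* (t ∷ ts) = leaves t + leaves* ts

  -- graft t i s grafts s on the leaf number i of t, where i < leaves t.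
  mutual
    graft : Tree G → ℕ → Tree G → Tree G
    graft leaf        i s = s
    graft (node x ts) i s = node x (graft* ts i s)

    graft* : ∀ {k} → Vec (Tree G) k → ℕ → Tree G → Vec (Tree G) k
    graft* []       i s = []
    graft* (t ∷ ts) i s with i <? leaves t
    ... | yes _ = graft t i s ∷ ts
    ... | no  _ = t ∷ graft* ts (i ∸ leaves t) s

  TreeOf : ℕ → Set g
  TreeOf n = Σ[ t ∈ Tree G ] leaves t ≡ suc n

  here : ∀ {k} t (ts : Vec (Tree G) k) {i} s → i < leaves t →
    graft* (t ∷ ts) i s ≡ graft t i s ∷ ts
  here t ts {i} s i< with i <? leaves t
  ... | yes _ = refl
  ... | no ¬p = contradiction i< ¬p

  there : ∀ {k} t (ts : Vec (Tree G) k) {i} s → leaves t ≤ i →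
    graft* (t ∷ ts) i s ≡ t ∷ graft* ts (i ∸ leaves t) s
  there t ts {i} s ≤i with i <? leaves t
  ... | yes p = contradiction p (≤⇒≯ ≤i)
  ... | no  _ = refl

  skip : ∀ {i} a b → a ≤ i → i < a + b → i ∸ a < b
  skip {i} a b a≤i i< =
    subst (i ∸ a <_) (m+n∸m≡n a b) (∸-monoˡ-< i< a≤i)

  mutual
    leaves-graft : ∀ t i s m → i < leaves t → leaves s ≡ suc m →
      leaves (graft t i s) ≡ leaves t + m
    leaves-graft leaf        i s m i< e = e
    leaves-graft (node x ts) i s m i< e = leaves-graft* ts i s m i< e

    leaves-graft* : ∀ {k} (ts : Vec (Tree G) k) i s m → i < leaves* ts →
      leaves s ≡ suc m → leaves* (graft* ts i s) ≡ leaves* ts + m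
    leaves-graft* (t ∷ ts) i s m i< e with i <? leaves t
    ... | yes p = trans (cong (_+ leaves* ts) (leaves-graft t i s m p e))
                    (swap-last (leaves t) m (leaves* ts))
    ... | no ¬p = trans
      (cong (leaves t +_)
        (leaves-graft* ts (i ∸ leaves t) s m (skip _ _ (≮⇒≥ ¬p) i<) e))
      (sym (+-assoc (leaves t) (leaves* ts) m))

  mutual
    graft-leaf : ∀ t i → graft t i leaf ≡ t
    graft-leaf leaf        i = refl
    graft-leaf (node x ts) i = cong (node x) (graft*-leaf ts i)

    graft*-leaf : ∀ {k} (ts : Vec (Tree G) k) i → graft* ts i leaf ≡ ts
    graft*-leaf []       i = refl
    graft*-leaf (t ∷ ts) i with i <? leaves t
    ... | yes _ = cong (_∷ ts) (graft-leaf t i)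
    ... | no  _ = cong (t ∷_) (graft*-leaf ts (i ∸ leaves t))

  mutual
    graft-nested : ∀ t i s j r m → i < leaves t → leaves s ≡ suc m → j < suc m →
      graft (graft t i s) (i + j) r ≡ graft t i (graft s j r)
    graft-nested leaf        zero    s j r m i< e j< = refl
    graft-nested leaf        (suc i) s j r m (s≤s ()) e j<
    graft-nested (node x ts) i       s j r m i< e j< =
      cong (node x) (graft*-nested ts i s j r m i< e j<)

    graft*-nested : ∀ {k} (ts : Vec (Tree G) k) i s j r m →
      i < leaves* ts → leaves s ≡ suc m → j < suc m →
      graft* (graft* ts i s) (i + j) r ≡ graft* ts i (graft s j r)
    graft*-nested (t ∷ ts) i s j r m i< e (s≤s j≤m) with i <? leaves t
    ... | yes p = trans
      (here (graft t i s) ts r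
        (subst (i + j <_) (sym (leaves-graft t i s m p e)) (+-mono-<-≤ p j≤m)))
      (cong (_∷ ts) (graft-nested t i s j r m p e (s≤s j≤m)))
    ... | no ¬p = trans
      (there t _ r (≤-trans (≮⇒≥ ¬p) (m≤m+n i j)))
      (cong (t ∷_) (trans
        (cong (λ q → graft* (graft* ts (i ∸ leaves t) s) q r) (+-∸-comm j (≮⇒≥ ¬p)))
        (graft*-nested ts (i ∸ leaves t) s j r m (skip _ _ (≮⇒≥ ¬p) i<) e (s≤s j≤m))))

  mutual
    graft-parallel : ∀ t i s j r m → i < j → j < leaves t → leaves s ≡ suc m →
      graft (graft t i s) (j + m) r ≡ graft (graft t j r) i s
    graft-parallel leaf        i s (suc j) r m i<j (s≤s ()) e
    graft-parallel (node x ts) i s j       r m i<j j< e =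
      cong (node x) (graft*-parallel ts i s j r m i<j j< e)

    graft*-parallel : ∀ {k} (ts : Vec (Tree G) k) i s j r m →
      i < j → j < leaves* ts → leaves s ≡ suc m →
      graft* (graft* ts i s) (j + m) r ≡ graft* (graft* ts j r) i s
    graft*-parallel (t ∷ ts) i s j r m i<j j< e with i <? leaves t | j <? leaves t
    ... | yes p | yes q = begin
      graft* (graft t i s ∷ ts) (j + m) r
        ≡⟨ here (graft t i s) ts r
             (subst (j + m <_) (sym (leaves-graft t i s m p e)) (+-monoˡ-< m q)) ⟩
      graft (graft t i s) (j + m) r ∷ ts
        ≡⟨ cong (_∷ ts) (graft-parallel t i s j r m i<j q e) ⟩
      graft (graft t j r) i s ∷ ts
        ≡⟨ here (graft t j r) ts s (graft-room t j r p i<j q) ⟨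
      graft* (graft t j r ∷ ts) i s ∎
      where open ≡-Reasoning
    ... | yes p | no ¬q = begin
      graft* (graft t i s ∷ ts) (j + m) r
        ≡⟨ there (graft t i s) ts r
             (subst (_≤ j + m) (sym e′) (+-monoˡ-≤ m (≮⇒≥ ¬q))) ⟩
      graft t i s ∷ graft* ts (j + m ∸ leaves (graft t i s)) r
        ≡⟨ cong (λ q → graft t i s ∷ graft* ts q r)
             (trans (cong (j + m ∸_) e′) ([m+n]∸[o+n]≡m∸o j (leaves t) m)) ⟩
      graft t i s ∷ graft* ts (j ∸ leaves t) r
        ≡⟨ here t _ s p ⟨
      graft* (t ∷ graft* ts (j ∸ leaves t) r) i s ∎
      where
      open ≡-Reasoning
      e′ : leaves (graft t i s) ≡ leaves t + m
      e′ = leaves-graft t i s m p e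
      [m+n]∸[o+n]≡m∸o : ∀ a b n → a + n ∸ (b + n) ≡ a ∸ b
      [m+n]∸[o+n]≡m∸o a b n =
        trans (cong₂ _∸_ (+-comm a n) (+-comm b n)) ([m+n]∸[m+o]≡n∸o n a b)
    ... | no ¬p | yes q = contradiction (<-trans i<j q) ¬p
    ... | no ¬p | no ¬q = begin
      graft* (t ∷ graft* ts (i ∸ leaves t) s) (j + m) r
        ≡⟨ there t _ r (≤-trans (≮⇒≥ ¬q) (m≤m+n j m)) ⟩
      t ∷ graft* (graft* ts (i ∸ leaves t) s) (j + m ∸ leaves t) r
        ≡⟨ cong (λ q → t ∷ graft* (graft* ts (i ∸ leaves t) s) q r)
             (+-∸-comm m (≮⇒≥ ¬q)) ⟩
      t ∷ graft* (graft* ts (i ∸ leaves t) s) (j ∸ leaves t + m) r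
        ≡⟨ cong (t ∷_) (graft*-parallel ts (i ∸ leaves t) s (j ∸ leaves t) r m
             (∸-monoˡ-< i<j (≮⇒≥ ¬p)) (skip _ _ (≮⇒≥ ¬q) j<) e) ⟩
      t ∷ graft* (graft* ts (j ∸ leaves t) r) (i ∸ leaves t) s
        ≡⟨ there t _ s (≮⇒≥ ¬p) ⟨
      graft* (t ∷ graft* ts (j ∸ leaves t) r) i s ∎
      where open ≡-Reasoning

    graft-room : ∀ t {i} j r → i < leaves t → i < j → j < leaves t →
      i < leaves (graft t j r)
    graft-room t {i} j r i<t i<j j<t = ≤-trans i<j (below t j r j<t)

    below : ∀ t j r → j < leaves t → j ≤ leaves (graft t j r)
    below leaf        zero    r j< = z≤n
    below leaf        (suc j) r (s≤s ())
    below (node x ts) j       r j< = below* ts j r j<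

    below* : ∀ {k} (ts : Vec (Tree G) k) j r → j < leaves* ts →
      j ≤ leaves* (graft* ts j r)
    below* (t ∷ ts) j r j< with j <? leaves t
    ... | yes p = ≤-trans (below t j r p) (m≤m+n _ (leaves* ts))
    ... | no ¬p = subst (_≤ leaves t + leaves* (graft* ts (j ∸ leaves t) r))
      (m+[n∸m]≡n (≮⇒≥ ¬p))
      (+-monoʳ-≤ (leaves t) (below* ts (j ∸ leaves t) r (skip _ _ (≮⇒≥ ¬p) j<)))

  TreeOf-≡ : ∀ {n} {t s : TreeOf n} → proj₁ t ≡ proj₁ s → t ≡ s
  TreeOf-≡ {t = t , p} {s = .t , q} refl = cong (t ,_) (≡-irrelevant p q)

  proj₁-subst : ∀ {n m} (e : n ≡ m) (t : TreeOf n) → proj₁ (subst TreeOf e t) ≡ proj₁ t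
  proj₁-subst refl t = refl

  toℕ<leaves : ∀ {n} (t : TreeOf n) (i : Fin (suc n)) → toℕ i < leaves (proj₁ t)
  toℕ<leaves (t , e) i = subst (toℕ i <_) (sym e) (Fin.toℕ<n i)

  infixl 7 _∘[_]_

  _∘[_]_ : ∀ {n m} → TreeOf n → Fin (suc n) → TreeOf m → TreeOf (n + m)
  _∘[_]_ {n} {m} (t , p) i (s , q) = graft t (toℕ i) s ,
    trans (leaves-graft t (toℕ i) s m (toℕ<leaves (t , p) i) q) (cong (_+ m) p)

  corolla : ∀ {n} → G n → TreeOf n
  corolla {n} x = node x (Vec.replicate (suc n) leaf) , leaves*-replicate (suc n)
    where
    leaves*-replicate : ∀ k → leaves* (Vec.replicate k leaf) ≡ k
    leaves*-replicate zero    = refl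
    leaves*-replicate (suc k) = cong suc (leaves*-replicate k)

  treeOperad : SetOperad g
  treeOperad = record
    { El     = TreeOf
    ; unit   = leaf , refl
    ; _∘[_]_ = _∘[_]_
    ; identityˡ = λ y → TreeOf-≡ refl
    ; identityʳ = λ {n} x i → TreeOf-≡
        (trans (proj₁-subst (+-identityʳ n) _) (graft-leaf (proj₁ x) (toℕ i)))
    ; assoc-nested = λ {n} {m} {l} x i y j z k e → TreeOf-≡
        (trans (proj₁-subst (+-assoc n m l) _)
          (trans (cong (λ q → graft _ q (proj₁ z)) e)
            (graft-nested (proj₁ x) (toℕ i) (proj₁ y) (toℕ j) (proj₁ z) m
              (toℕ<leaves x i) (proj₂ y) (Fin.toℕ<n j))))
    ; assoc-parallel = λ {n} {m} {l} x i y j z i′ j′ i<j e₁ e₂ → TreeOf-≡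
        (trans (proj₁-subst (swap-last n m l) _)
          (trans (cong (λ q → graft _ q (proj₁ z)) e₂)
            (trans (graft-parallel (proj₁ x) (toℕ i) (proj₁ y) (toℕ j) (proj₁ z) m
                      i<j (toℕ<leaves x j) (proj₂ y))
              (cong (λ q → graft (graft (proj₁ x) (toℕ j) (proj₁ z)) q (proj₁ y))
                (sym e₁)))))
    }

-- A classical field is a HeytingField whose apartness is the negation of equality.

fieldRing : HeytingField c ℓ₁ ℓ₂ → CommutativeRing c ℓ₁
fieldRing 𝕂 = HeytingCommutativeRing.commutativeRing (HeytingField.heytingCommutativeRing 𝕂)

CharacteristicZero : HeytingField c ℓ₁ ℓ₂ → Set ℓ₁
CharacteristicZero 𝕂 = ∀ n → ¬ (suc n ×′ 1# ≈ 0#)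
  where
  open CommutativeRing (fieldRing 𝕂)
  open import Algebra.Definitions.RawMonoid +-rawMonoid using () renaming (_×_ to _×′_)

module LinearOperads (𝕂 : HeytingField c ℓ₁ ℓ₂) where

  private
    commutativeRing : CommutativeRing c ℓ₁
    commutativeRing = fieldRing 𝕂
    module 𝕂 = CommutativeRing commutativeRing
    open 𝕂 using () renaming (Carrier to K)

    variable
      m m₁ m₂ ℓ ℓm₁ ℓm₂ p r : Level

  VectorSpace : ∀ m ℓ → Set (c ⊔ ℓ₁ ⊔ lsuc (m ⊔ ℓ))
  VectorSpace m ℓ = Module commutativeRing m ℓ

  -- Lin B, with the equality _≋_, is the vector space with basis B: _≋_ is the
  -- least congruence satisfying the vector space axioms, and linear maps out of it
  -- are given by their values on B (extend, extend-cong).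

  infix  4 _≋_
  infixl 6 _⊕_
  infixr 7 _·_

  data Lin (B : Set b) : Set (c ⊔ b) where
    η   : B → Lin B
    𝟘   : Lin B
    _⊕_ : Lin B → Lin B → Lin B
    _·_ : K → Lin B → Lin B

  data _≋_ {B : Set b} : Lin B → Lin B → Set (c ⊔ ℓ₁ ⊔ b) where
    ≋-refl      : ∀ {x} → x ≋ x
    ≋-sym       : ∀ {x y} → x ≋ y → y ≋ x
    ≋-trans     : ∀ {x y z} → x ≋ y → y ≋ z → x ≋ z
    ⊕-cong      : ∀ {x x′ y y′} → x ≋ x′ → y ≋ y′ → x ⊕ y ≋ x′ ⊕ y′
    ·-cong      : ∀ {k k′ x x′} → k 𝕂.≈ k′ → x ≋ x′ → k · x ≋ k′ · x′
    ⊕-assoc     : ∀ x y z → (x ⊕ y) ⊕ z ≋ x ⊕ (y ⊕ z)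
    ⊕-comm      : ∀ x y → x ⊕ y ≋ y ⊕ x
    ⊕-identityˡ : ∀ x → 𝟘 ⊕ x ≋ x
    ·-zeroˡ     : ∀ x → 𝕂.0# · x ≋ 𝟘
    ·-identityˡ : ∀ x → 𝕂.1# · x ≋ x
    ·-assoc     : ∀ k l x → (k 𝕂.* l) · x ≋ k · (l · x)
    ·-distribʳ  : ∀ x k l → (k 𝕂.+ l) · x ≋ k · x ⊕ l · x
    ·-distribˡ  : ∀ k x y → k · (x ⊕ y) ≋ k · x ⊕ k · y

  module _ (B : Set b) where

    private
      ⊕-inverseʳ : ∀ (x : Lin B) → x ⊕ (𝕂.- 𝕂.1#) · x ≋ 𝟘
      ⊕-inverseʳ x =
        ≋-trans (⊕-cong (≋-sym (·-identityˡ x)) ≋-refl)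
          (≋-trans (≋-sym (·-distribʳ x 𝕂.1# (𝕂.- 𝕂.1#)))
            (≋-trans (·-cong (𝕂.-‿inverseʳ 𝕂.1#) ≋-refl) (·-zeroˡ x)))

      ·-zeroʳ : ∀ k → _≋_ {B = B} (k · 𝟘) 𝟘
      ·-zeroʳ k =
        ≋-trans (·-cong 𝕂.refl (≋-sym (·-zeroˡ 𝟘)))
          (≋-trans (≋-sym (·-assoc k 𝕂.0# 𝟘))
            (≋-trans (·-cong (𝕂.zeroʳ k) ≋-refl) (·-zeroˡ 𝟘)))

    linSpace : VectorSpace (c ⊔ b) (c ⊔ ℓ₁ ⊔ b)
    linSpace = record
      { Carrierᴹ = Lin B
      ; _≈ᴹ_     = _≋_
      ; _+ᴹ_     = _⊕_
      ; _*ₗ_     = _·_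
      ; _*ᵣ_     = λ x k → k · x
      ; 0ᴹ       = 𝟘
      ; -ᴹ_      = (𝕂.- 𝕂.1#) ·_
      ; isModule = IsModuleFromLeft.isModule {commutativeRing = commutativeRing} (record
        { isLeftModule = record
          { isLeftSemimodule = record
            { +ᴹ-isCommutativeMonoid = record
              { isMonoid = record
                { isSemigroup = record
                  { isMagma = record
                    { isEquivalence = record
                      { refl = ≋-refl ; sym = ≋-sym ; trans = ≋-trans }
                    ; ∙-cong = ⊕-cong
                    }
                  ; assoc = ⊕-assoc
                  }
                ; identity = ⊕-identityˡ ,
                    λ x → ≋-trans (⊕-comm x 𝟘) (⊕-identityˡ x)
                }
              ; comm = ⊕-comm
              }
            ; isPreleftSemimodule = record
              { *ₗ-cong      = ·-cong
              ; *ₗ-zeroˡ     = ·-zeroˡ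
              ; *ₗ-distribʳ  = ·-distribʳ
              ; *ₗ-identityˡ = ·-identityˡ
              ; *ₗ-assoc     = ·-assoc
              ; *ₗ-zeroʳ     = ·-zeroʳ
              ; *ₗ-distribˡ  = ·-distribˡ
              }
            }
          ; -ᴹ‿cong    = ·-cong 𝕂.refl
          ; -ᴹ‿inverse = (λ x → ≋-trans (⊕-comm _ x) (⊕-inverseʳ x)) , ⊕-inverseʳ
          }
        })
      }

  module _ {B : Set b} (V : VectorSpace m ℓ) where
    open Module V
    open CommutativeSemigroupProperties
      (CommutativeMonoid.commutativeSemigroup +ᴹ-commutativeMonoid) using (interchange)

    extend : (B → Carrierᴹ) → Lin B → Carrierᴹ
    extend f (η x)   = f x
    extend f 𝟘       = 0ᴹ
    extend f (x ⊕ y) = extend f x +ᴹ extend f y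
    extend f (k · x) = k *ₗ extend f x

    extend-cong : ∀ f {x y} → x ≋ y → extend f x ≈ᴹ extend f y
    extend-cong f ≋-refl             = ≈ᴹ-refl
    extend-cong f (≋-sym e)          = ≈ᴹ-sym (extend-cong f e)
    extend-cong f (≋-trans d e)      = ≈ᴹ-trans (extend-cong f d) (extend-cong f e)
    extend-cong f (⊕-cong d e)       = +ᴹ-cong (extend-cong f d) (extend-cong f e)
    extend-cong f (·-cong d e)       = *ₗ-cong d (extend-cong f e)
    extend-cong f (⊕-assoc x y z)    = +ᴹ-assoc _ _ _
    extend-cong f (⊕-comm x y)       = +ᴹ-comm _ _
    extend-cong f (⊕-identityˡ x)    = +ᴹ-identityˡ _
    extend-cong f (·-zeroˡ x)        = *ₗ-zeroˡ _
    extend-cong f (·-identityˡ x)    = *ₗ-identityˡ _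
    extend-cong f (·-assoc k l x)    = *ₗ-assoc k l _
    extend-cong f (·-distribʳ x k l) = *ₗ-distribʳ _ k l
    extend-cong f (·-distribˡ k x y) = *ₗ-distribˡ k _ _

    extend-ext : ∀ {f g} → (∀ x → f x ≈ᴹ g x) → ∀ x → extend f x ≈ᴹ extend g x
    extend-ext e (η x)   = e x
    extend-ext e 𝟘       = ≈ᴹ-refl
    extend-ext e (x ⊕ y) = +ᴹ-cong (extend-ext e x) (extend-ext e y)
    extend-ext e (k · x) = *ₗ-cong 𝕂.refl (extend-ext e x)

    extend-+ : ∀ f g x → extend (λ b → f b +ᴹ g b) x ≈ᴹ extend f x +ᴹ extend g x
    extend-+ f g (η x)   = ≈ᴹ-refl
    extend-+ f g 𝟘       = ≈ᴹ-sym (+ᴹ-identityˡ _)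
    extend-+ f g (x ⊕ y) =
      ≈ᴹ-trans (+ᴹ-cong (extend-+ f g x) (extend-+ f g y)) (interchange _ _ _ _)
    extend-+ f g (k · x) =
      ≈ᴹ-trans (*ₗ-cong 𝕂.refl (extend-+ f g x)) (*ₗ-distribˡ k _ _)

    extend-* : ∀ k f x → extend (λ b → k *ₗ f b) x ≈ᴹ k *ₗ extend f x
    extend-* k f (η x)   = ≈ᴹ-refl
    extend-* k f 𝟘       = ≈ᴹ-sym (*ₗ-zeroʳ k)
    extend-* k f (x ⊕ y) =
      ≈ᴹ-trans (+ᴹ-cong (extend-* k f x) (extend-* k f y)) (≈ᴹ-sym (*ₗ-distribˡ k _ _))
    extend-* k f (l · x) =
      ≈ᴹ-trans (*ₗ-cong 𝕂.refl (extend-* k f x))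
        (≈ᴹ-trans (≈ᴹ-sym (*ₗ-assoc l k _))
          (≈ᴹ-trans (*ₗ-cong (𝕂.*-comm l k) ≈ᴹ-refl) (*ₗ-assoc k l _)))

  module _ (V : VectorSpace m ℓ) where
    open Module V

    record Subspace p : Set (c ⊔ m ⊔ ℓ ⊔ lsuc p) where
      infix 4 _∈
      field
        _∈     : Carrierᴹ → Set p
        ∈-resp : ∀ {x y} → x ≈ᴹ y → x ∈ → y ∈
        0∈     : 0ᴹ ∈
        +∈     : ∀ {x y} → x ∈ → y ∈ → x +ᴹ y ∈
        *∈     : ∀ k {x} → x ∈ → k *ₗ x ∈

    data Span (X : Carrierᴹ → Set p) : Carrierᴹ → Set (c ⊔ m ⊔ ℓ ⊔ p) where
      gen  : ∀ {x} → X x → Span X x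
      resp : ∀ {x y} → x ≈ᴹ y → Span X x → Span X y
      zer  : Span X 0ᴹ
      add  : ∀ {x y} → Span X x → Span X y → Span X (x +ᴹ y)
      mul  : ∀ k {x} → Span X x → Span X (k *ₗ x)

    span : (Carrierᴹ → Set p) → Subspace (c ⊔ m ⊔ ℓ ⊔ p)
    span X = record
      { _∈ = Span X ; ∈-resp = resp ; 0∈ = zer ; +∈ = add ; *∈ = mul }

    neg≈ : ∀ x → (𝕂.- 𝕂.1#) *ₗ x ≈ᴹ -ᴹ x
    neg≈ x = uniqueʳ‿-ᴹ x ((𝕂.- 𝕂.1#) *ₗ x)
      (≈ᴹ-trans (+ᴹ-cong (≈ᴹ-sym (*ₗ-identityˡ x)) ≈ᴹ-refl)
        (≈ᴹ-trans (≈ᴹ-sym (*ₗ-distribʳ x 𝕂.1# (𝕂.- 𝕂.1#)))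
          (≈ᴹ-trans (*ₗ-cong (𝕂.-‿inverseʳ 𝕂.1#) ≈ᴹ-refl) (*ₗ-zeroˡ x))))

    *ₗ-neg : ∀ k x → k *ₗ (-ᴹ x) ≈ᴹ -ᴹ (k *ₗ x)
    *ₗ-neg k x =
      ≈ᴹ-trans (*ₗ-cong 𝕂.refl (≈ᴹ-sym (neg≈ x)))
        (≈ᴹ-trans (≈ᴹ-sym (*ₗ-assoc k _ x))
          (≈ᴹ-trans (*ₗ-cong (𝕂.*-comm k _) ≈ᴹ-refl)
            (≈ᴹ-trans (*ₗ-assoc _ k x) (neg≈ (k *ₗ x)))))

  module _ {V : VectorSpace m ℓ} (W : Subspace V p) where
    open Module V
    open Subspace W
    open import Algebra.Properties.AbelianGroup +ᴹ-abelianGroup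
      using (⁻¹-anti-homo-//; ⁻¹-∙-comm)
    open CommutativeSemigroupProperties
      (CommutativeMonoid.commutativeSemigroup +ᴹ-commutativeMonoid) using (interchange)

    neg∈ : ∀ {x} → x ∈ → -ᴹ x ∈
    neg∈ {x} x∈ = ∈-resp (neg≈ V x) (*∈ (𝕂.- 𝕂.1#) x∈)

    subspace : VectorSpace (m ⊔ p) ℓ
    subspace = record
      { Carrierᴹ = Σ Carrierᴹ _∈
      ; _≈ᴹ_     = λ x y → proj₁ x ≈ᴹ proj₁ y
      ; _+ᴹ_     = λ (x , x∈) (y , y∈) → x +ᴹ y , +∈ x∈ y∈
      ; _*ₗ_     = λ k (x , x∈) → k *ₗ x , *∈ k x∈
      ; _*ᵣ_     = λ (x , x∈) k → k *ₗ x , *∈ k x∈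
      ; 0ᴹ       = 0ᴹ , 0∈
      ; -ᴹ_      = λ (x , x∈) → -ᴹ x , neg∈ x∈
      ; isModule = IsModuleFromLeft.isModule {commutativeRing = commutativeRing} (record
        { isLeftModule = record
          { isLeftSemimodule = record
            { +ᴹ-isCommutativeMonoid = record
              { isMonoid = record
                { isSemigroup = record
                  { isMagma = record
                    { isEquivalence = record
                      { refl = ≈ᴹ-refl ; sym = ≈ᴹ-sym ; trans = ≈ᴹ-trans }
                    ; ∙-cong = +ᴹ-cong
                    }
                  ; assoc = λ _ _ _ → +ᴹ-assoc _ _ _
                  }
                ; identity = (λ _ → +ᴹ-identityˡ _) , (λ _ → +ᴹ-identityʳ _)
                }
              ; comm = λ _ _ → +ᴹ-comm _ _
              }
            ; isPreleftSemimodule = record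
              { *ₗ-cong      = *ₗ-cong
              ; *ₗ-zeroˡ     = λ _ → *ₗ-zeroˡ _
              ; *ₗ-distribʳ  = λ _ _ _ → *ₗ-distribʳ _ _ _
              ; *ₗ-identityˡ = λ _ → *ₗ-identityˡ _
              ; *ₗ-assoc     = λ _ _ _ → *ₗ-assoc _ _ _
              ; *ₗ-zeroʳ     = λ _ → *ₗ-zeroʳ _
              ; *ₗ-distribˡ  = λ _ _ _ → *ₗ-distribˡ _ _ _
              }
            }
          ; -ᴹ‿cong    = -ᴹ‿cong
          ; -ᴹ‿inverse = (λ _ → -ᴹ‿inverseˡ _) , (λ _ → -ᴹ‿inverseʳ _)
          }
        })
      }

    infix 4 _∼_
    _∼_ : Carrierᴹ → Carrierᴹ → Set p
    x ∼ y = x +ᴹ (-ᴹ y) ∈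

    ≈⇒∼ : ∀ {x y} → x ≈ᴹ y → x ∼ y
    ≈⇒∼ {x} {y} e =
      ∈-resp (≈ᴹ-sym (≈ᴹ-trans (+ᴹ-cong e ≈ᴹ-refl) (-ᴹ‿inverseʳ y))) 0∈

    private
      ∼-trans : ∀ {x y z} → x ∼ y → y ∼ z → x ∼ z
      ∼-trans {x} {y} {z} d e = ∈-resp (begin
        (x +ᴹ (-ᴹ y)) +ᴹ (y +ᴹ (-ᴹ z)) ≈⟨ +ᴹ-assoc x (-ᴹ y) _ ⟩
        x +ᴹ ((-ᴹ y) +ᴹ (y +ᴹ (-ᴹ z))) ≈⟨ +ᴹ-cong ≈ᴹ-refl (+ᴹ-assoc (-ᴹ y) y _) ⟨
        x +ᴹ (((-ᴹ y) +ᴹ y) +ᴹ (-ᴹ z)) ≈⟨ +ᴹ-cong ≈ᴹ-refl (+ᴹ-cong (-ᴹ‿inverseˡ y) ≈ᴹ-refl) ⟩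
        x +ᴹ (0ᴹ +ᴹ (-ᴹ z))            ≈⟨ +ᴹ-cong ≈ᴹ-refl (+ᴹ-identityˡ _) ⟩
        x +ᴹ (-ᴹ z)                    ∎) (+∈ d e)
        where open import Relation.Binary.Reasoning.Setoid ≈ᴹ-setoid

      ∼-+ : ∀ {x y u v} → x ∼ y → u ∼ v → x +ᴹ u ∼ y +ᴹ v
      ∼-+ {x} {y} {u} {v} d e = ∈-resp
        (≈ᴹ-trans (interchange x (-ᴹ y) u (-ᴹ v)) (+ᴹ-cong ≈ᴹ-refl (⁻¹-∙-comm y v)))
        (+∈ d e)

      ∼-* : ∀ {k l x y} → k 𝕂.≈ l → x ∼ y → k *ₗ x ∼ l *ₗ y
      ∼-* {k} {l} {x} {y} d e = ∈-resp
        (≈ᴹ-trans (*ₗ-distribˡ k x (-ᴹ y)) (+ᴹ-cong ≈ᴹ-refl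
          (≈ᴹ-trans (*ₗ-neg V k y) (-ᴹ‿cong (*ₗ-cong d ≈ᴹ-refl)))))
        (*∈ k e)

      ∼-neg : ∀ {x y} → x ∼ y → -ᴹ x ∼ -ᴹ y
      ∼-neg {x} {y} e = ∈-resp (≈ᴹ-sym (⁻¹-∙-comm x (-ᴹ y))) (neg∈ e)

    quotientSpace : VectorSpace m p
    quotientSpace = record
      { Carrierᴹ = Carrierᴹ
      ; _≈ᴹ_     = _∼_
      ; _+ᴹ_     = _+ᴹ_
      ; _*ₗ_     = _*ₗ_
      ; _*ᵣ_     = λ x k → k *ₗ x
      ; 0ᴹ       = 0ᴹ
      ; -ᴹ_      = -ᴹ_
      ; isModule = IsModuleFromLeft.isModule {commutativeRing = commutativeRing} (record
        { isLeftModule = record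
          { isLeftSemimodule = record
            { +ᴹ-isCommutativeMonoid = record
              { isMonoid = record
                { isSemigroup = record
                  { isMagma = record
                    { isEquivalence = record
                      { refl  = ≈⇒∼ ≈ᴹ-refl
                      ; sym   = λ {x} {y} e → ∈-resp (⁻¹-anti-homo-// x y) (neg∈ e)
                      ; trans = ∼-trans
                      }
                    ; ∙-cong = ∼-+
                    }
                  ; assoc = λ x y z → ≈⇒∼ (+ᴹ-assoc x y z)
                  }
                ; identity = (λ x → ≈⇒∼ (+ᴹ-identityˡ x)) , (λ x → ≈⇒∼ (+ᴹ-identityʳ x))
                }
              ; comm = λ x y → ≈⇒∼ (+ᴹ-comm x y)
              }
            ; isPreleftSemimodule = record
              { *ₗ-cong      = ∼-*
              ; *ₗ-zeroˡ     = λ x → ≈⇒∼ (*ₗ-zeroˡ x)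
              ; *ₗ-distribʳ  = λ x k l → ≈⇒∼ (*ₗ-distribʳ x k l)
              ; *ₗ-identityˡ = λ x → ≈⇒∼ (*ₗ-identityˡ x)
              ; *ₗ-assoc     = λ k l x → ≈⇒∼ (*ₗ-assoc k l x)
              ; *ₗ-zeroʳ     = λ k → ≈⇒∼ (*ₗ-zeroʳ k)
              ; *ₗ-distribˡ  = λ k x y → ≈⇒∼ (*ₗ-distribˡ k x y)
              }
            }
          ; -ᴹ‿cong    = ∼-neg
          ; -ᴹ‿inverse = (λ x → ≈⇒∼ (-ᴹ‿inverseˡ x)) , (λ x → ≈⇒∼ (-ᴹ‿inverseʳ x))
          }
        })
      }

  record Operad m ℓ : Set (c ⊔ ℓ₁ ⊔ lsuc (m ⊔ ℓ)) where
    infixl 7 _∘[_]_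
    field
      space : ℕ → VectorSpace m ℓ

    El : ℕ → Set m
    El n = Module.Carrierᴹ (space n)

    module Space {n} = Module (space n)
    open Space using (_≈ᴹ_; _+ᴹ_; _*ₗ_)

    field
      unit   : El 0
      _∘[_]_ : ∀ {n m} → El n → Fin (suc n) → El m → El (n + m)

      ∘-cong : ∀ {n m} {x x′ : El n} i {y y′ : El m} →
        x ≈ᴹ x′ → y ≈ᴹ y′ → x ∘[ i ] y ≈ᴹ x′ ∘[ i ] y′
      ∘-+ˡ : ∀ {n m} (x x′ : El n) i (y : El m) →
        (x +ᴹ x′) ∘[ i ] y ≈ᴹ x ∘[ i ] y +ᴹ x′ ∘[ i ] y
      ∘-*ˡ : ∀ {n m} k (x : El n) i (y : El m) →
        (k *ₗ x) ∘[ i ] y ≈ᴹ k *ₗ (x ∘[ i ] y)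
      ∘-+ʳ : ∀ {n m} (x : El n) i (y y′ : El m) →
        x ∘[ i ] (y +ᴹ y′) ≈ᴹ x ∘[ i ] y +ᴹ x ∘[ i ] y′
      ∘-*ʳ : ∀ {n m} k (x : El n) i (y : El m) →
        x ∘[ i ] (k *ₗ y) ≈ᴹ k *ₗ (x ∘[ i ] y)

      identityˡ : ∀ {m} (y : El m) → unit ∘[ zero ] y ≈ᴹ y
      identityʳ : ∀ {n} (x : El n) i →
        subst El (+-identityʳ n) (x ∘[ i ] unit) ≈ᴹ x
      assoc-nested : ∀ {n m l} (x : El n) i (y : El m) j (z : El l) k →
        toℕ k ≡ toℕ i + toℕ j →
        subst El (+-assoc n m l) (x ∘[ i ] y ∘[ k ] z) ≈ᴹ x ∘[ i ] (y ∘[ j ] z)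
      assoc-parallel : ∀ {n m l} (x : El n) i (y : El m) j (z : El l) i′ j′ →
        toℕ i < toℕ j → toℕ i′ ≡ toℕ i → toℕ j′ ≡ toℕ j + m →
        subst El (swap-last n m l) (x ∘[ i ] y ∘[ j′ ] z) ≈ᴹ x ∘[ j ] z ∘[ i′ ] y

  record _≅_ (O : Operad m₁ ℓm₁) (P : Operad m₂ ℓm₂) :
             Set (c ⊔ m₁ ⊔ ℓm₁ ⊔ m₂ ⊔ ℓm₂) where
    private
      module O = Operad O
      module P = Operad P
    field
      ⟦_⟧ : ∀ {n} → O.El n → P.El n
      isModuleIsomorphism : ∀ n → ModuleMorphisms.IsModuleIsomorphism
        (Module.rawModule (O.space n)) (Module.rawModule (P.space n)) ⟦_⟧
      unit-homo : P.Space._≈ᴹ_ ⟦ O.unit ⟧ P.unit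
      ∘-homo : ∀ {n m} (x : O.El n) i (y : O.El m) →
        P.Space._≈ᴹ_ ⟦ x O.∘[ i ] y ⟧ (⟦ x ⟧ P.∘[ i ] ⟦ y ⟧)

  module _ (S : SetOperad b) where
    private
      module S = SetOperad S

      L : ℕ → Set (c ⊔ b)
      L n = Lin (S.El n)

      infix 4 _≈_
      _≈_ : ∀ {n} → L n → L n → Set (c ⊔ ℓ₁ ⊔ b)
      _≈_ = _≋_

      infixl 7 _∘[_]_
      _∘[_]_ : ∀ {n m} → L n → Fin (suc n) → L m → L (n + m)
      x ∘[ i ] y = extend (linSpace _) (λ s → extend (linSpace _) (λ t → η (s S.∘[ i ] t)) y) x

      ∘-+ʳ : ∀ {n m} (x : L n) i (y y′ : L m) →
        x ∘[ i ] (y ⊕ y′) ≈ x ∘[ i ] y ⊕ x ∘[ i ] y′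
      ∘-+ʳ x i y y′ = extend-+ (linSpace _) _ _ x

      ∘-*ʳ : ∀ {n m} k (x : L n) i (y : L m) → x ∘[ i ] (k · y) ≈ k · (x ∘[ i ] y)
      ∘-*ʳ k x i y = extend-* (linSpace _) k _ x

      ∘-𝟘ʳ : ∀ {n m} (x : L n) i → x ∘[ i ] (𝟘 {B = S.El m}) ≈ 𝟘
      ∘-𝟘ʳ {n} {m} x i =
        ≋-trans (extend-ext V (λ _ → ≈ᴹ-sym (*ₗ-zeroˡ 𝟘)) x)
          (≋-trans (extend-* V 𝕂.0# (λ _ → 𝟘) x) (*ₗ-zeroˡ _))
        where
        V : VectorSpace (c ⊔ b) (c ⊔ ℓ₁ ⊔ b)
        V = linSpace (S.El (n + m))
        open Module V

      subst-η : ∀ {n m} (e : n ≡ m) s → subst L e (η s) ≡ η (subst S.El e s)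
      subst-η refl s = refl

      subst-𝟘 : ∀ {n m} (e : n ≡ m) → subst L e 𝟘 ≡ 𝟘
      subst-𝟘 refl = refl

      subst-⊕ : ∀ {n m} (e : n ≡ m) x y → subst L e (x ⊕ y) ≡ subst L e x ⊕ subst L e y
      subst-⊕ refl x y = refl

      subst-· : ∀ {n m} (e : n ≡ m) k x → subst L e (k · x) ≡ k · subst L e x
      subst-· refl k x = refl

      ≡⇒≈ : ∀ {n} {x y : L n} → x ≡ y → x ≈ y
      ≡⇒≈ refl = ≋-refl

      on-η : ∀ {n m} (e : n ≡ m) {s t} → subst S.El e s ≡ t → subst L e (η s) ≈ η t
      on-η e {s} p = ≡⇒≈ (trans (subst-η e s) (cong η p))

      on-𝟘 : ∀ {n m} (e : n ≡ m) {y} → y ≈ 𝟘 → subst L e 𝟘 ≈ y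
      on-𝟘 e p = ≋-trans (≡⇒≈ (subst-𝟘 e)) (≋-sym p)

      on-⊕ : ∀ {n m} (e : n ≡ m) {x x′ y y′ z} →
        subst L e x ≈ y → subst L e x′ ≈ y′ → z ≈ y ⊕ y′ → subst L e (x ⊕ x′) ≈ z
      on-⊕ e p q d = ≋-trans (≡⇒≈ (subst-⊕ e _ _)) (≋-trans (⊕-cong p q) (≋-sym d))

      on-· : ∀ {n m} (e : n ≡ m) {k x y z} →
        subst L e x ≈ y → z ≈ k · y → subst L e (k · x) ≈ z
      on-· e p d = ≋-trans (≡⇒≈ (subst-· e _ _)) (≋-trans (·-cong 𝕂.refl p) (≋-sym d))

      identityˡ : ∀ {m} (y : L m) → η S.unit ∘[ zero ] y ≈ y
      identityˡ (η s)   = ≡⇒≈ (cong η (S.identityˡ s))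
      identityˡ 𝟘       = ≋-refl
      identityˡ (y ⊕ z) = ⊕-cong (identityˡ y) (identityˡ z)
      identityˡ (k · y) = ·-cong 𝕂.refl (identityˡ y)

      identityʳ : ∀ {n} (x : L n) i → subst L (+-identityʳ n) (x ∘[ i ] η S.unit) ≈ x
      identityʳ {n} (η s)   i = on-η (+-identityʳ n) (S.identityʳ s i)
      identityʳ {n} 𝟘       i = on-𝟘 (+-identityʳ n) ≋-refl
      identityʳ {n} (x ⊕ y) i = on-⊕ (+-identityʳ n) (identityʳ x i) (identityʳ y i) ≋-refl
      identityʳ {n} (k · x) i = on-· (+-identityʳ n) (identityʳ x i) ≋-refl

      module _ {n m l : ℕ} (i : Fin (suc n)) (j : Fin (suc m)) (k : Fin (suc (n + m)))
               (d : toℕ k ≡ toℕ i + toℕ j) where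

        private
          e : n + m + l ≡ n + (m + l)
          e = +-assoc n m l

        assoc-nested : (x : L n) (y : L m) (z : L l) →
          subst L e (x ∘[ i ] y ∘[ k ] z) ≈ x ∘[ i ] (y ∘[ j ] z)
        assoc-nested (η s)    (η t)    (η u)    = on-η e (S.assoc-nested s i t j u k d)
        assoc-nested (η s)    (η t)    𝟘        = on-𝟘 e ≋-refl
        assoc-nested (η s)    (η t)    (z ⊕ z′) =
          on-⊕ e (assoc-nested (η s) (η t) z) (assoc-nested (η s) (η t) z′) ≋-refl
        assoc-nested (η s)    (η t)    (q · z)  = on-· e (assoc-nested (η s) (η t) z) ≋-refl
        assoc-nested (η s)    𝟘        z        = on-𝟘 e ≋-refl
        assoc-nested (η s)    (y ⊕ y′) z        =
          on-⊕ e (assoc-nested (η s) y z) (assoc-nested (η s) y′ z) ≋-refl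
        assoc-nested (η s)    (q · y)  z        = on-· e (assoc-nested (η s) y z) ≋-refl
        assoc-nested 𝟘        y        z        = on-𝟘 e ≋-refl
        assoc-nested (x ⊕ x′) y        z        =
          on-⊕ e (assoc-nested x y z) (assoc-nested x′ y z) ≋-refl
        assoc-nested (q · x)  y        z        = on-· e (assoc-nested x y z) ≋-refl

      module _ {n m l : ℕ} (i : Fin (suc n)) (j : Fin (suc n)) (i′ : Fin (suc (n + l)))
               (j′ : Fin (suc (n + m))) (i<j : toℕ i < toℕ j)
               (d : toℕ i′ ≡ toℕ i) (d′ : toℕ j′ ≡ toℕ j + m) where

        private
          e : n + m + l ≡ n + l + m
          e = swap-last n m l

        assoc-parallel : (x : L n) (y : L m) (z : L l) →
          subst L e (x ∘[ i ] y ∘[ j′ ] z) ≈ x ∘[ j ] z ∘[ i′ ] y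
        assoc-parallel (η s) (η t) (η u) = on-η e (S.assoc-parallel s i t j u i′ j′ i<j d d′)
        assoc-parallel (η s) (η t) 𝟘 = on-𝟘 e ≋-refl
        assoc-parallel (η s) (η t) (z ⊕ z′) =
          on-⊕ e (assoc-parallel (η s) (η t) z) (assoc-parallel (η s) (η t) z′) ≋-refl
        assoc-parallel (η s) (η t) (q · z) = on-· e (assoc-parallel (η s) (η t) z) ≋-refl
        assoc-parallel (η s) 𝟘 z = on-𝟘 e (∘-𝟘ʳ (η s ∘[ j ] z) i′)
        assoc-parallel (η s) (y ⊕ y′) z =
          on-⊕ e (assoc-parallel (η s) y z) (assoc-parallel (η s) y′ z)
            (∘-+ʳ (η s ∘[ j ] z) i′ y y′)
        assoc-parallel (η s) (q · y) z =
          on-· e (assoc-parallel (η s) y z) (∘-*ʳ q (η s ∘[ j ] z) i′ y)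
        assoc-parallel 𝟘 y z = on-𝟘 e ≋-refl
        assoc-parallel (x ⊕ x′) y z =
          on-⊕ e (assoc-parallel x y z) (assoc-parallel x′ y z) ≋-refl
        assoc-parallel (q · x) y z = on-· e (assoc-parallel x y z) ≋-refl

    linearOperad : Operad (c ⊔ b) (c ⊔ ℓ₁ ⊔ b)
    linearOperad = record
      { space  = λ n → linSpace (S.El n)
      ; unit   = η S.unit
      ; _∘[_]_ = _∘[_]_
      ; ∘-cong = λ {n} {m} {x} {x′} i p q → ≋-trans
          (extend-cong (linSpace _) _ p)
          (extend-ext (linSpace _) (λ s → extend-cong (linSpace _) _ q) x′)
      ; ∘-+ˡ   = λ x x′ i y → ≋-refl
      ; ∘-*ˡ   = λ k x i y → ≋-refl
      ; ∘-+ʳ   = ∘-+ʳ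
      ; ∘-*ʳ   = ∘-*ʳ
      ; identityˡ      = identityˡ
      ; identityʳ      = identityʳ
      ; assoc-nested   = λ x i y j z k d → assoc-nested i j k d x y z
      ; assoc-parallel = λ x i y j z i′ j′ i<j d d′ →
          assoc-parallel i j i′ j′ i<j d d′ x y z
      }

  module _ (O : Operad m ℓ) where
    open Operad O
    open Space using (Carrierᴹ; _≈ᴹ_; _+ᴹ_; _*ₗ_; 0ᴹ; -ᴹ_)

    record Suboperad p : Set (c ⊔ m ⊔ ℓ ⊔ lsuc p) where
      field
        subspaces : ∀ n → Subspace (space n) p
      module In {n} = Subspace (subspaces n)
      open In using (_∈)
      field
        unit∈ : unit ∈
        ∘∈    : ∀ {n m} {x : El n} i {y : El m} → x ∈ → y ∈ → x ∘[ i ] y ∈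

    record Ideal p : Set (c ⊔ m ⊔ ℓ ⊔ lsuc p) where
      field
        subspaces : ∀ n → Subspace (space n) p
      module In {n} = Subspace (subspaces n)
      open In using (_∈)
      field
        ∘∈ˡ : ∀ {n m} {x : El n} i (y : El m) → x ∈ → x ∘[ i ] y ∈
        ∘∈ʳ : ∀ {n m} (x : El n) i {y : El m} → y ∈ → x ∘[ i ] y ∈

    data InSuboperad (X : ∀ n → El n → Set p) : ∀ n → El n → Set (c ⊔ m ⊔ ℓ ⊔ p) where
      gen  : ∀ {n x} → X n x → InSuboperad X n x
      resp : ∀ {n x y} → x ≈ᴹ y → InSuboperad X n x → InSuboperad X n y
      zer  : ∀ {n} → InSuboperad X n 0ᴹ
      add  : ∀ {n x y} → InSuboperad X n x → InSuboperad X n y → InSuboperad X n (x +ᴹ y)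
      mul  : ∀ {n} k {x} → InSuboperad X n x → InSuboperad X n (k *ₗ x)
      one  : InSuboperad X 0 unit
      comp : ∀ {n m x} i {y} → InSuboperad X n x → InSuboperad X m y →
             InSuboperad X (n + m) (x ∘[ i ] y)

    generatedSuboperad : (∀ n → El n → Set p) → Suboperad (c ⊔ m ⊔ ℓ ⊔ p)
    generatedSuboperad X = record
      { subspaces = λ n → record
        { _∈ = InSuboperad X n ; ∈-resp = resp ; 0∈ = zer ; +∈ = add ; *∈ = mul }
      ; unit∈ = one
      ; ∘∈    = comp
      }

    data InIdeal (X : ∀ n → El n → Set p) : ∀ n → El n → Set (c ⊔ m ⊔ ℓ ⊔ p) where
      gen   : ∀ {n x} → X n x → InIdeal X n x
      resp  : ∀ {n x y} → x ≈ᴹ y → InIdeal X n x → InIdeal X n y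
      zer   : ∀ {n} → InIdeal X n 0ᴹ
      add   : ∀ {n x y} → InIdeal X n x → InIdeal X n y → InIdeal X n (x +ᴹ y)
      mul   : ∀ {n} k {x} → InIdeal X n x → InIdeal X n (k *ₗ x)
      compˡ : ∀ {n m x} i (y : El m) → InIdeal X n x → InIdeal X (n + m) (x ∘[ i ] y)
      compʳ : ∀ {n m} (x : El n) i {y} → InIdeal X m y → InIdeal X (n + m) (x ∘[ i ] y)

    generatedIdeal : (∀ n → Subspace (space n) p) → Ideal (c ⊔ m ⊔ ℓ ⊔ p)
    generatedIdeal R = record
      { subspaces = λ n → record
        { _∈ = InIdeal X n ; ∈-resp = resp ; 0∈ = zer ; +∈ = add ; *∈ = mul }
      ; ∘∈ˡ = compˡ
      ; ∘∈ʳ = compʳ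
      }
      where
      X : ∀ n → El n → Set _
      X n = Subspace._∈ (R n)

  module _ {O : Operad m ℓ} where
    open Operad O
    open Space

    suboperad : Suboperad O p → Operad (m ⊔ p) ℓ
    suboperad {p = p} S = record
      { space  = λ n → subspace (subspaces n)
      ; unit   = unit , unit∈
      ; _∘[_]_ = λ (x , x∈) i (y , y∈) → x ∘[ i ] y , ∘∈ i x∈ y∈
      ; ∘-cong = λ i d e → ∘-cong i d e
      ; ∘-+ˡ   = λ _ _ i _ → ∘-+ˡ _ _ i _
      ; ∘-*ˡ   = λ k _ i _ → ∘-*ˡ k _ i _
      ; ∘-+ʳ   = λ _ i _ _ → ∘-+ʳ _ i _ _
      ; ∘-*ʳ   = λ k _ i _ → ∘-*ʳ k _ i _
      ; identityˡ = λ _ → identityˡ _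
      ; identityʳ = λ {n} (x , _) i →
          under (+-identityʳ n) (identityʳ x i)
      ; assoc-nested = λ {n} {m} {l} (x , _) i (y , _) j (z , _) k d →
          under (+-assoc n m l) (assoc-nested x i y j z k d)
      ; assoc-parallel = λ {n} {m} {l} (x , _) i (y , _) j (z , _) i′ j′ i<j d d′ →
          under (swap-last n m l) (assoc-parallel x i y j z i′ j′ i<j d d′)
      }
      where
      open Suboperad S
      open In using (_∈)
      Elₛ : ℕ → Set _
      Elₛ n = Σ (El n) _∈
      under : ∀ {n m} (e : n ≡ m) {x : Elₛ n} {y : El m} →
        subst El e (proj₁ x) ≈ᴹ y → proj₁ (subst Elₛ e x) ≈ᴹ y
      under refl q = q

    quotient : Ideal O p → Operad m p
    quotient I = record
      { space  = λ n → quotientSpace (subspaces n)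
      ; unit   = unit
      ; _∘[_]_ = _∘[_]_
      ; ∘-cong = λ {n} {m} {x} {x′} i {y} {y′} d e →
          Module.≈ᴹ-trans (quotientSpace (subspaces (n + m)))
            (∈-resp (-ˡ x x′ i y) (∘∈ˡ i y d))
            (∈-resp (-ʳ x′ i y y′) (∘∈ʳ x′ i e))
      ; ∘-+ˡ = λ x x′ i y → ≈⇒∼ (subspaces _) (∘-+ˡ x x′ i y)
      ; ∘-*ˡ = λ k x i y → ≈⇒∼ (subspaces _) (∘-*ˡ k x i y)
      ; ∘-+ʳ = λ x i y y′ → ≈⇒∼ (subspaces _) (∘-+ʳ x i y y′)
      ; ∘-*ʳ = λ k x i y → ≈⇒∼ (subspaces _) (∘-*ʳ k x i y)
      ; identityˡ = λ y → ≈⇒∼ (subspaces _) (identityˡ y)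
      ; identityʳ = λ x i → ≈⇒∼ (subspaces _) (identityʳ x i)
      ; assoc-nested = λ x i y j z k d → ≈⇒∼ (subspaces _) (assoc-nested x i y j z k d)
      ; assoc-parallel = λ x i y j z i′ j′ i<j d d′ →
          ≈⇒∼ (subspaces _) (assoc-parallel x i y j z i′ j′ i<j d d′)
      }
      where
      open Ideal I
      open In using (∈-resp)
      -ˡ : ∀ {n m} (x x′ : El n) i (y : El m) →
        (x +ᴹ (-ᴹ x′)) ∘[ i ] y ≈ᴹ x ∘[ i ] y +ᴹ (-ᴹ (x′ ∘[ i ] y))
      -ˡ x x′ i y = ≈ᴹ-trans (∘-+ˡ x _ i y) (+ᴹ-cong ≈ᴹ-refl
        (≈ᴹ-trans (∘-cong i (≈ᴹ-sym (neg≈ (space _) x′)) ≈ᴹ-refl)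
          (≈ᴹ-trans (∘-*ˡ _ x′ i y) (neg≈ (space _) _))))
      -ʳ : ∀ {n m} (x : El n) i (y y′ : El m) →
        x ∘[ i ] (y +ᴹ (-ᴹ y′)) ≈ᴹ x ∘[ i ] y +ᴹ (-ᴹ (x ∘[ i ] y′))
      -ʳ x i y y′ = ≈ᴹ-trans (∘-+ʳ x i y _) (+ᴹ-cong ≈ᴹ-refl
        (≈ᴹ-trans (∘-cong i ≈ᴹ-refl (≈ᴹ-sym (neg≈ (space _) y′)))
          (≈ᴹ-trans (∘-*ʳ _ x i y′) (neg≈ (space _) _))))

  Free : (G : GradedSet g) → Operad (c ⊔ g) (c ⊔ ℓ₁ ⊔ g)
  Free G = linearOperad (Trees.treeOperad G)

  IsPresentation : Operad m ℓ → (G : GradedSet g) →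
    (∀ n → Subspace (Operad.space (Free G) n) p) → Set (c ⊔ ℓ₁ ⊔ m ⊔ ℓ ⊔ g ⊔ p)
  IsPresentation O G R = O ≅ quotient (generatedIdeal (Free G) R)

  module _ {G : GradedSet g} where
    open Trees G using (TreeOf)

    induced : (∀ {n} → TreeOf n → TreeOf n → Set r) →
      ∀ n → Subspace (Operad.space (Free G) n) (c ⊔ ℓ₁ ⊔ g ⊔ r)
    induced _↔_ n = span V (λ v → ∃[ x ] ∃[ x′ ] (x ↔ x′ × v ≡ η x +ᴹ (-ᴹ η x′)))
      where
      V : VectorSpace (c ⊔ g) (c ⊔ ℓ₁ ⊔ g)
      V = Operad.space (Free G) n
      open Module V using (_+ᴹ_; -ᴹ_)

-- {0} ∪ [γ] is Fin (suc γ), with a : Fin γ standing for suc a in [γ].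

module _ (γ : ℕ) where
  open Max (Fin.≤-totalOrder (suc γ)) using (⊔-isMonoid) renaming (_⊔_ to _⊔ₘ_)

  maxIsMonoid : IsMonoid _≡_ _⊔ₘ_ (zero {γ})
  maxIsMonoid = ⊔-isMonoid (λ _ → z≤n)

module _ (𝕂 : HeytingField c ℓ₁ ℓ₂) (γ : ℕ) where
  open LinearOperads 𝕂

  TM : Operad c (c ⊔ ℓ₁)
  TM = linearOperad (wordOperad (maxIsMonoid γ))

  data DiasWord : ∀ n → Operad.El TM n → Set c where
    0a : (a : Fin γ) → DiasWord 1 (η (zero ∷ suc a ∷ []))
    a0 : (a : Fin γ) → DiasWord 1 (η (suc a ∷ zero ∷ []))

  Dias : Operad (c ⊔ ℓ₁) (c ⊔ ℓ₁)
  Dias = suboperad (generatedSuboperad TM DiasWord)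

data Generator (γ : ℕ) : GradedSet 0ℓ where
  ⊣ ⊢ : Fin γ → Generator γ 1

module _ {γ : ℕ} where
  open Trees (Generator γ)

  infixl 7 _∘₁_ _∘₂_
  infix  4 _⇿_

  _∘₁_ _∘₂_ : Generator γ 1 → Generator γ 1 → TreeOf 2
  x ∘₁ y = corolla x ∘[ zero ] corolla y
  x ∘₂ y = corolla x ∘[ suc zero ] corolla y

  data _⇿_ : ∀ {n} → TreeOf n → TreeOf n → Set where
    ⊣⊢  : ∀ a a′            → ⊣ a ∘₁ ⊢ a′ ⇿ ⊢ a′ ∘₂ ⊣ a
    ⊣<₁ : ∀ {a b} → a Fin.< b → ⊣ a ∘₁ ⊣ b ⇿ ⊣ a ∘₂ ⊢ b
    ⊢<₁ : ∀ {a b} → a Fin.< b → ⊢ a ∘₁ ⊣ b ⇿ ⊢ a ∘₂ ⊢ b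
    ⊣<₂ : ∀ {a b} → a Fin.< b → ⊣ b ∘₁ ⊣ a ⇿ ⊣ a ∘₂ ⊣ b
    ⊢<₂ : ∀ {a b} → a Fin.< b → ⊢ a ∘₁ ⊢ b ⇿ ⊢ b ∘₂ ⊢ a
    ⊣≤₁ : ∀ {c d} → c Fin.≤ d → ⊣ d ∘₁ ⊣ d ⇿ ⊣ d ∘₂ ⊣ c
    ⊣≤₂ : ∀ {c d} → c Fin.≤ d → ⊣ d ∘₂ ⊣ c ⇿ ⊣ d ∘₂ ⊢ c
    ⊢≤₁ : ∀ {c d} → c Fin.≤ d → ⊢ d ∘₁ ⊣ c ⇿ ⊢ d ∘₁ ⊢ c
    ⊢≤₂ : ∀ {c d} → c Fin.≤ d → ⊢ d ∘₁ ⊢ c ⇿ ⊢ d ∘₂ ⊢ d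

  _↔γ_ : ∀ {n} → TreeOf n → TreeOf n → Set
  _↔γ_ = EqClosure _⇿_

module _ (𝕂 : HeytingField c ℓ₁ ℓ₂) (γ : ℕ) where
  open LinearOperads 𝕂

  DiasRelations : ∀ n → Subspace (Operad.space (Free (Generator γ)) n) (c ⊔ ℓ₁)
  DiasRelations = induced _↔γ_

{-# OPTIONS --safe #-}

-- Evaluating trees in TM_γ kills the relations, so there is a map from the quotient
-- onto Dias_γ.  Writing x ⊣ₐ y and x ⊢ₐ y for a tree with root ⊣ₐ or ⊢ₐ, the relations
-- amount to five identities valid for all a and b, where ∨ is the maximum:
--   (x ⊢_b y) ⊣ₐ z = x ⊢_b (y ⊣ₐ z),
--   x ⊣ₐ (y ⊢_b z) = (x ⊣_{a∨b} y) ⊣ₐ z,    x ⊣ₐ (y ⊣_b z) = (x ⊣ₐ y) ⊣_{a∨b} z,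
--   (x ⊣_b y) ⊢ₐ z = x ⊢ₐ (y ⊢_{a∨b} z),    (x ⊢_b y) ⊢ₐ z = x ⊢_{a∨b} (y ⊢ₐ z).
-- They rewrite any tree as a comb, leaves attached by ⊢ on the left of a leaf and by ⊣
-- on its right, whose evaluation is the word u 0 v of its labels.  The comb can be read
-- off the word, which inverts the evaluation.

module Submission where

open import Defs
open import Algebra.Apartness.Bundles using (HeytingField)
open import Algebra.Bundles using (CommutativeRing)
open import Algebra.Module.Bundles using (Module)
open import Algebra.Structures using (IsMonoid)
import Algebra.Construct.NaturalChoice.Max as Max
open import Data.Fin.Base as Fin using (Fin; zero; suc; toℕ)
import Data.Fin.Properties as Fin
open import Data.List.Base as List using (List; []; _∷_; _++_; foldl; foldr)
import Data.List.Properties as List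
open import Data.Maybe.Base as Maybe using (Maybe; just; nothing)
open import Data.Nat.Base using (ℕ; zero; suc; _+_; _∸_; _<_; z≤n; s≤s)
open import Data.Nat.Properties
open import Data.Product.Base using (Σ-syntax; ∃-syntax; ∃₂; _×_; _,_; proj₁; proj₂)
open import Data.Sum.Base using (inj₁; inj₂)
open import Data.Vec.Base as Vec using (Vec; []; _∷_)
import Data.Vec.Properties as Vec
open import Function.Base using (_∘_)
open import Level using (Level)
open import Relation.Binary.Construct.Closure.Equivalence as EqClosure using ()
open import Relation.Binary.PropositionalEquality
  using (_≡_; refl; sym; trans; cong; cong₂; subst; isEquivalence; module ≡-Reasoning)
open import Relation.Nullary using (yes; no; contradiction)

private
  variable
    c ℓ₁ ℓ₂ g b b′ : Level

-- Evaluation of trees as words over a monoid.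

module Evaluation {G : GradedSet g} {M : Set b} {_∙_ : M → M → M} {ε : M}
                  (isMonoid : IsMonoid _≡_ _∙_ ε)
                  (word : ∀ {k} → G k → Vec M (suc k)) where

  open Trees G using (TreeOf; leaves; leaves*; graft; graft*; skip; toℕ<leaves; corolla)
  open Words _∙_ using (insert; toList-∘; toList-inj)
  open Words.Laws _∙_ isMonoid using (insert-++; insert-map; module M)

  mutual
    -- Lists avoid arity transports in the recursion. Each letter of the node's word multiplies the
    -- whole word of the child at that place, which amounts to composing at all inputs at once.
    eval : Tree G → List M
    eval leaf        = ε ∷ []
    eval (node x ts) = eval* (word x) ts

    eval* : ∀ {k} → Vec M k → Vec (Tree G) k → List M
    eval* []       []       = []
    eval* (y ∷ ys) (t ∷ ts) = List.map (y ∙_) (eval t) ++ eval* ys ts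

  mutual
    length-eval : ∀ t → List.length (eval t) ≡ leaves t
    length-eval leaf        = refl
    length-eval (node x ts) = length-eval* (word x) ts

    length-eval* : ∀ {k} (ys : Vec M k) ts → List.length (eval* ys ts) ≡ leaves* ts
    length-eval* []       []       = refl
    length-eval* (y ∷ ys) (t ∷ ts) = trans (List.length-++ (List.map (y ∙_) (eval t)))
      (cong₂ _+_ (trans (List.length-map (y ∙_) (eval t)) (length-eval t)) (length-eval* ys ts))

  mutual
    -- On a leaf this is the left unit law. At a node, grafting inside the first child commutes with
    -- multiplication by `y` because the product is associative (`insert-map`); grafting further
    -- right passes over a prefix of length `leaves t`.
    eval-graft : ∀ t i s → i < leaves t → eval (graft t i s) ≡ insert (eval t) i (eval s)
    eval-graft leaf zero    s i< = sym (trans (List.++-identityʳ _)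
      (trans (List.map-cong M.identityˡ (eval s)) (List.map-id (eval s))))
    eval-graft leaf (suc i) s (s≤s ())
    eval-graft (node x ts) i s i< = eval*-graft (word x) ts i s i<

    eval*-graft : ∀ {k} (ys : Vec M k) ts i s → i < leaves* ts →
      eval* ys (graft* ts i s) ≡ insert (eval* ys ts) i (eval s)
    eval*-graft (y ∷ ys) (t ∷ ts) i s i< with i <? leaves t
    ... | yes p = trans
      (cong (λ w → List.map (y ∙_) w ++ eval* ys ts) (eval-graft t i s p))
      (sym (insert-map y (eval t) i (eval s) (eval* ys ts)
        (subst (i <_) (sym (length-eval t)) p)))
    ... | no ¬p = begin
      w ++ eval* ys (graft* ts (i ∸ leaves t) s)
        ≡⟨ cong (w ++_) (eval*-graft ys ts (i ∸ leaves t) s (skip _ _ (≮⇒≥ ¬p) i<)) ⟩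
      w ++ insert (eval* ys ts) (i ∸ leaves t) (eval s)
        ≡⟨ insert-++ w (eval* ys ts) (i ∸ leaves t) (eval s) ⟨
      insert (w ++ eval* ys ts) (List.length w + (i ∸ leaves t)) (eval s)
        ≡⟨ cong (λ j → insert (w ++ eval* ys ts) j (eval s))
             (trans (cong (_+ (i ∸ leaves t))
                      (trans (List.length-map (y ∙_) (eval t)) (length-eval t)))
               (m+[n∸m]≡n (≮⇒≥ ¬p))) ⟩
      insert (w ++ eval* ys ts) i (eval s) ∎
      where
      open ≡-Reasoning
      w : List M
      w = List.map (y ∙_) (eval t)

  evaluate : ∀ {n} → TreeOf n → Vec M (suc n)
  evaluate (t , e) = Vec.cast (trans (length-eval t) e) (Vec.fromList (eval t))

  toList-evaluate : ∀ {n} (t : TreeOf n) → Vec.toList (evaluate t) ≡ eval (proj₁ t)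
  toList-evaluate (t , e) =
    trans (Vec.toList-cast (trans (length-eval t) e) (Vec.fromList (eval t)))
      (Vec.toList∘fromList (eval t))

  evaluate-≡ : ∀ {n} (t : TreeOf n) v → eval (proj₁ t) ≡ Vec.toList v → evaluate t ≡ v
  evaluate-≡ t v e = toList-inj _ _ (trans (toList-evaluate t) e)

  evaluate-∘ : ∀ {n m} (t : TreeOf n) i (s : TreeOf m) →
    evaluate (Trees._∘[_]_ G t i s) ≡ Words._∘[_]_ _∙_ (evaluate t) i (evaluate s)
  evaluate-∘ t i s = evaluate-≡ (Trees._∘[_]_ G t i s) _ (begin
    eval (graft (proj₁ t) (toℕ i) (proj₁ s))
      ≡⟨ eval-graft (proj₁ t) (toℕ i) (proj₁ s) (toℕ<leaves t i) ⟩
    insert (eval (proj₁ t)) (toℕ i) (eval (proj₁ s))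
      ≡⟨ cong₂ (λ u v → insert u (toℕ i) v) (toList-evaluate t) (toList-evaluate s) ⟨
    insert (Vec.toList (evaluate t)) (toℕ i) (Vec.toList (evaluate s))
      ≡⟨ toList-∘ (evaluate t) i (evaluate s) ⟨
    Vec.toList (Words._∘[_]_ _∙_ (evaluate t) i (evaluate s)) ∎)
    where open ≡-Reasoning

  evaluate-corolla : ∀ {n} (x : G n) → evaluate (corolla x) ≡ word x
  evaluate-corolla x = evaluate-≡ (corolla x) (word x) (eval*-leaves (word x))
    where
    eval*-leaves : ∀ {k} (ys : Vec M k) → eval* ys (Vec.replicate k leaf) ≡ Vec.toList ys
    eval*-leaves []       = refl
    eval*-leaves (y ∷ ys) = cong₂ _∷_ (M.identityʳ y) (eval*-leaves ys)

-- Evaluation in the max monoid respects the relations.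

module _ {γ : ℕ} where

  open Trees (Generator γ) using (TreeOf; leaves)
  open Max (Fin.≤-totalOrder (suc γ)) using () renaming
    (_⊔_ to _⊔ₘ_; x≤y⇒x⊔y≈y to ⊔ₘ-≤; x≤y⇒y⊔x≈y to ⊔ₘ-≥)
  open Max (Fin.≤-totalOrder γ) using (_⊔_; x≤y⇒x⊔y≈y; x≤y⇒y⊔x≈y)

  generatorWord : ∀ {k} → Generator γ k → Vec (Fin (suc γ)) (suc k)
  generatorWord (⊣ a) = zero ∷ suc a ∷ []
  generatorWord (⊢ a) = suc a ∷ zero ∷ []

  open Evaluation (maxIsMonoid γ) generatorWord public

  ⊔ₘ-zeroˡ : ∀ (a : Fin (suc γ)) → zero ⊔ₘ a ≡ a
  ⊔ₘ-zeroˡ a = ⊔ₘ-≤ z≤n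

  ⊔ₘ-zeroʳ : ∀ (a : Fin (suc γ)) → a ⊔ₘ zero ≡ a
  ⊔ₘ-zeroʳ a = ⊔ₘ-≥ z≤n

  suc-⊔ : ∀ (a b : Fin γ) → suc a ⊔ₘ suc b ≡ suc (a ⊔ b)
  suc-⊔ a b with Fin.≤-total a b
  ... | inj₁ a≤b = trans (⊔ₘ-≤ (s≤s a≤b)) (cong suc (sym (x≤y⇒x⊔y≈y a≤b)))
  ... | inj₂ b≤a = trans (⊔ₘ-≥ (s≤s b≤a)) (cong suc (sym (x≤y⇒y⊔x≈y b≤a)))

  private
    first second : Generator γ 1 → Fin (suc γ)
    first  x = Vec.head (generatorWord x)
    second x = Vec.last (generatorWord x)

    -- Turns a relation between two-node trees into three equalities of maxima.
    eval-∘₁ : ∀ (x y : Generator γ 1) → eval (proj₁ (x ∘₁ y)) ≡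
      first x ⊔ₘ first y ∷ first x ⊔ₘ second y ∷ second x ∷ []
    eval-∘₁ x y = trans (sym (toList-evaluate (x ∘₁ y))) (cong Vec.toList
      (trans (evaluate-∘ (Trees.corolla _ x) zero (Trees.corolla _ y))
        (trans (cong₂ (λ u v → Words._∘[_]_ _⊔ₘ_ u zero v) (evaluate-corolla x) (evaluate-corolla y))
          (word-∘₁ x y))))
      where
      word-∘₁ : ∀ (x y : Generator γ 1) →
        Words._∘[_]_ _⊔ₘ_ (generatorWord x) zero (generatorWord y) ≡
        first x ⊔ₘ first y ∷ first x ⊔ₘ second y ∷ second x ∷ []
      word-∘₁ (⊣ a) (⊣ b) = refl
      word-∘₁ (⊣ a) (⊢ b) = refl
      word-∘₁ (⊢ a) (⊣ b) = refl
      word-∘₁ (⊢ a) (⊢ b) = refl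

    eval-∘₂ : ∀ (x y : Generator γ 1) → eval (proj₁ (x ∘₂ y)) ≡
      first x ∷ second x ⊔ₘ first y ∷ second x ⊔ₘ second y ∷ []
    eval-∘₂ x y = trans (sym (toList-evaluate (x ∘₂ y))) (cong Vec.toList
      (trans (evaluate-∘ (Trees.corolla _ x) (suc zero) (Trees.corolla _ y))
        (trans (cong₂ (λ u v → Words._∘[_]_ _⊔ₘ_ u (suc zero) v)
                 (evaluate-corolla x) (evaluate-corolla y))
          (word-∘₂ x y))))
      where
      word-∘₂ : ∀ (x y : Generator γ 1) →
        Words._∘[_]_ _⊔ₘ_ (generatorWord x) (suc zero) (generatorWord y) ≡
        first x ∷ second x ⊔ₘ first y ∷ second x ⊔ₘ second y ∷ []
      word-∘₂ (⊣ a) (⊣ b) = refl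
      word-∘₂ (⊣ a) (⊢ b) = refl
      word-∘₂ (⊢ a) (⊣ b) = refl
      word-∘₂ (⊢ a) (⊢ b) = refl

    ∷-cong₃ : ∀ {x x′ y y′ z z′ : Fin (suc γ)} → x ≡ x′ → y ≡ y′ → z ≡ z′ →
      List._∷_ x (y ∷ z ∷ []) ≡ x′ ∷ y′ ∷ z′ ∷ []
    ∷-cong₃ refl refl refl = refl

  -- 0 is neutral, and `a < b` or `c ≤ d` decides each remaining maximum. In the order of the
  -- constructors the common words are a′0a; 0ba, ab0, 0ab, ba0; then 0dd for both `⊣≤` and dd0 for
  -- both `⊢≤`.
  eval-⇿ : ∀ {n} {s t : TreeOf n} → s ⇿ t → eval (proj₁ s) ≡ eval (proj₁ t)
  eval-⇿ (⊣⊢ a a′) = trans (eval-∘₁ (⊣ a) (⊢ a′)) (trans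
    (∷-cong₃ (⊔ₘ-zeroˡ _) refl (sym (⊔ₘ-zeroˡ _)))
    (sym (eval-∘₂ (⊢ a′) (⊣ a))))
  eval-⇿ (⊣<₁ {a} {b} a<b) = trans (eval-∘₁ (⊣ a) (⊣ b)) (trans
    (∷-cong₃ (⊔ₘ-zeroˡ _) (trans (⊔ₘ-zeroˡ _) (sym (⊔ₘ-≤ (s≤s (<⇒≤ a<b))))) (sym (⊔ₘ-zeroʳ _)))
    (sym (eval-∘₂ (⊣ a) (⊢ b))))
  eval-⇿ (⊢<₁ {a} {b} a<b) = trans (eval-∘₁ (⊢ a) (⊣ b)) (trans
    (∷-cong₃ (⊔ₘ-zeroʳ _) (trans (⊔ₘ-≤ (s≤s (<⇒≤ a<b))) (sym (⊔ₘ-zeroˡ _))) (sym (⊔ₘ-zeroˡ _)))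
    (sym (eval-∘₂ (⊢ a) (⊢ b))))
  eval-⇿ (⊣<₂ {a} {b} a<b) = trans (eval-∘₁ (⊣ b) (⊣ a)) (trans
    (∷-cong₃ (⊔ₘ-zeroˡ _) (trans (⊔ₘ-zeroˡ _) (sym (⊔ₘ-zeroʳ _))) (sym (⊔ₘ-≤ (s≤s (<⇒≤ a<b)))))
    (sym (eval-∘₂ (⊣ a) (⊣ b))))
  eval-⇿ (⊢<₂ {a} {b} a<b) = trans (eval-∘₁ (⊢ a) (⊢ b)) (trans
    (∷-cong₃ (⊔ₘ-≤ (s≤s (<⇒≤ a<b))) (trans (⊔ₘ-zeroʳ _) (sym (⊔ₘ-zeroˡ _))) (sym (⊔ₘ-zeroˡ _)))
    (sym (eval-∘₂ (⊢ b) (⊢ a))))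
  eval-⇿ (⊣≤₁ {c} {d} c≤d) = trans (eval-∘₁ (⊣ d) (⊣ d)) (trans
    (∷-cong₃ (⊔ₘ-zeroˡ _) (trans (⊔ₘ-zeroˡ _) (sym (⊔ₘ-zeroʳ _))) (sym (⊔ₘ-≥ (s≤s c≤d))))
    (sym (eval-∘₂ (⊣ d) (⊣ c))))
  eval-⇿ (⊣≤₂ {c} {d} c≤d) = trans (eval-∘₂ (⊣ d) (⊣ c)) (trans
    (∷-cong₃ refl (trans (⊔ₘ-zeroʳ _) (sym (⊔ₘ-≥ (s≤s c≤d))))
      (trans (⊔ₘ-≥ (s≤s c≤d)) (sym (⊔ₘ-zeroʳ _))))
    (sym (eval-∘₂ (⊣ d) (⊢ c))))
  eval-⇿ (⊢≤₁ {c} {d} c≤d) = trans (eval-∘₁ (⊢ d) (⊣ c)) (trans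
    (∷-cong₃ (trans (⊔ₘ-zeroʳ _) (sym (⊔ₘ-≥ (s≤s c≤d))))
      (trans (⊔ₘ-≥ (s≤s c≤d)) (sym (⊔ₘ-zeroʳ _))) refl)
    (sym (eval-∘₁ (⊢ d) (⊢ c))))
  eval-⇿ (⊢≤₂ {c} {d} c≤d) = trans (eval-∘₁ (⊢ d) (⊢ c)) (trans
    (∷-cong₃ (⊔ₘ-≥ (s≤s c≤d)) (trans (⊔ₘ-zeroʳ _) (sym (⊔ₘ-zeroˡ _))) (sym (⊔ₘ-zeroˡ _)))
    (sym (eval-∘₂ (⊢ d) (⊢ d))))

  -- Combs and their words.

  letters : List (Fin γ) → List (Fin γ) → List (Fin (suc γ))
  letters u v = List.map suc u ++ zero ∷ List.map suc v

  infixl 7 _⊣[_]_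
  infixr 7 _⊢[_]_

  _⊣[_]_ _⊢[_]_ : Tree (Generator γ) → Fin γ → Tree (Generator γ) → Tree (Generator γ)
  s ⊣[ a ] t = node (⊣ a) (s ∷ t ∷ [])
  s ⊢[ a ] t = node (⊢ a) (s ∷ t ∷ [])

  lefts : List (Fin γ) → Tree (Generator γ) → Tree (Generator γ)
  lefts u t = foldr (leaf ⊢[_]_) t u

  rights : Tree (Generator γ) → List (Fin γ) → Tree (Generator γ)
  rights = foldl (_⊣[_] leaf)

  comb : List (Fin γ) → List (Fin γ) → Tree (Generator γ)
  comb u v = lefts u (rights leaf v)

  -- The tree is an accumulator because `rights` is a left fold: the last letter labels the root. A
  -- second zero makes the reading fail.
  attachRight : Tree (Generator γ) → List (Fin (suc γ)) → Maybe (Tree (Generator γ))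
  attachRight t []          = just t
  attachRight t (zero  ∷ w) = nothing
  attachRight t (suc a ∷ w) = attachRight (t ⊣[ a ] leaf) w

  readComb : List (Fin (suc γ)) → Maybe (Tree (Generator γ))
  readComb []          = nothing
  readComb (zero  ∷ w) = attachRight leaf w
  readComb (suc a ∷ w) = Maybe.map (leaf ⊢[ a ]_) (readComb w)

  readComb-letters : ∀ u v → readComb (letters u v) ≡ just (comb u v)
  readComb-letters []      v = attachRight-suc leaf v
    where
    attachRight-suc : ∀ t v → attachRight t (List.map suc v) ≡ just (rights t v)
    attachRight-suc t []      = refl
    attachRight-suc t (a ∷ v) = attachRight-suc (t ⊣[ a ] leaf) v
  readComb-letters (a ∷ u) v = cong (Maybe.map (leaf ⊢[ a ]_)) (readComb-letters u v)

  private
    map-suc-⊔ : ∀ a u →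
      List.map (suc a ⊔ₘ_) (List.map suc u) ≡ List.map suc (List.map (a ⊔_) u)
    map-suc-⊔ a u = trans (sym (List.map-∘ u)) (trans (List.map-cong (suc-⊔ a) u) (List.map-∘ u))

    map-zero-⊔ : ∀ w → List.map (zero ⊔ₘ_) w ≡ w
    map-zero-⊔ w = trans (List.map-cong ⊔ₘ-zeroˡ w) (List.map-id w)

    -- A positive letter absorbs the zero, which becomes `a` itself, so no zero is left.
    raise : ∀ a u v → List.map (suc a ⊔ₘ_) (letters u v) ≡
      List.map suc (List.map (a ⊔_) u ++ a ∷ List.map (a ⊔_) v)
    raise a u v = begin
      List.map (suc a ⊔ₘ_) (letters u v)
        ≡⟨ List.map-++ (suc a ⊔ₘ_) (List.map suc u) _ ⟩
      List.map (suc a ⊔ₘ_) (List.map suc u) ++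
        (suc a ⊔ₘ zero) ∷ List.map (suc a ⊔ₘ_) (List.map suc v)
        ≡⟨ cong₂ _++_ (map-suc-⊔ a u) (cong₂ _∷_ (⊔ₘ-zeroʳ (suc a)) (map-suc-⊔ a v)) ⟩
      List.map suc (List.map (a ⊔_) u) ++ List.map suc (a ∷ List.map (a ⊔_) v)
        ≡⟨ List.map-++ suc (List.map (a ⊔_) u) _ ⟨
      List.map suc (List.map (a ⊔_) u ++ a ∷ List.map (a ⊔_) v) ∎
      where open ≡-Reasoning

  -- Only the left factor keeps its zero. The list of labels on the right is the one that `comb-⊣`
  -- obtains by rewriting.
  letters-⊣ : ∀ a u v u′ v′ →
    List.map (zero ⊔ₘ_) (letters u v) ++ List.map (suc a ⊔ₘ_) (letters u′ v′) ++ [] ≡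
    letters u (v ++ List.map (a ⊔_) u′ ++ a ∷ List.map (a ⊔_) v′)
  letters-⊣ a u v u′ v′ = begin
    List.map (zero ⊔ₘ_) (letters u v) ++ List.map (suc a ⊔ₘ_) (letters u′ v′) ++ []
      ≡⟨ cong₂ _++_ (map-zero-⊔ (letters u v))
           (trans (List.++-identityʳ _) (raise a u′ v′)) ⟩
    letters u v ++ List.map suc w
      ≡⟨ List.++-assoc (List.map suc u) _ _ ⟩
    List.map suc u ++ zero ∷ (List.map suc v ++ List.map suc w)
      ≡⟨ cong (λ z → List.map suc u ++ zero ∷ z) (List.map-++ suc v w) ⟨
    letters u (v ++ w) ∎
    where
    open ≡-Reasoning
    w : List (Fin γ)
    w = List.map (a ⊔_) u′ ++ a ∷ List.map (a ⊔_) v′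

  letters-⊢ : ∀ a u v u′ v′ →
    List.map (suc a ⊔ₘ_) (letters u v) ++ List.map (zero ⊔ₘ_) (letters u′ v′) ++ [] ≡
    letters ((List.map (a ⊔_) u ++ a ∷ List.map (a ⊔_) v) ++ u′) v′
  letters-⊢ a u v u′ v′ = begin
    List.map (suc a ⊔ₘ_) (letters u v) ++ List.map (zero ⊔ₘ_) (letters u′ v′) ++ []
      ≡⟨ cong₂ _++_ (raise a u v)
           (trans (List.++-identityʳ _) (map-zero-⊔ (letters u′ v′))) ⟩
    List.map suc w ++ letters u′ v′
      ≡⟨ List.++-assoc (List.map suc w) _ _ ⟨
    (List.map suc w ++ List.map suc u′) ++ zero ∷ List.map suc v′
      ≡⟨ cong (_++ _) (List.map-++ suc w u′) ⟨
    letters (w ++ u′) v′ ∎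
    where
    open ≡-Reasoning
    w : List (Fin γ)
    w = List.map (a ⊔_) u ++ a ∷ List.map (a ⊔_) v

-- Linear extension of maps between set operads.

module LinearMaps (𝕂 : HeytingField c ℓ₁ ℓ₂) where

  open LinearOperads 𝕂 hiding (_∼_; ≈⇒∼)

  private
    module 𝕂 = CommutativeRing (fieldRing 𝕂)

  linear : {A : Set b} {B : Set b′} → (A → B) → Lin A → Lin B
  linear f = extend (linSpace _) (η ∘ f)

  -- Composition recurses on the left factor and, at a basis element, on the right one. The
  -- induction follows this order, so only the basis case needs `f-∘`.
  linear-∘ : (S : SetOperad b) (T : SetOperad b′)
    (f : ∀ {n} → SetOperad.El S n → SetOperad.El T n) →
    (∀ {n m} (s : SetOperad.El S n) i (t : SetOperad.El S m) →
      f (SetOperad._∘[_]_ S s i t) ≡ SetOperad._∘[_]_ T (f s) i (f t)) →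
    ∀ {n m} (x : Lin (SetOperad.El S n)) i (y : Lin (SetOperad.El S m)) →
    linear f (Operad._∘[_]_ (linearOperad S) x i y) ≋
    Operad._∘[_]_ (linearOperad T) (linear f x) i (linear f y)
  linear-∘ S T f f-∘ {n} {m} x i y = go x y
    where
    go : (x : Lin (SetOperad.El S n)) (y : Lin (SetOperad.El S m)) →
      linear f (Operad._∘[_]_ (linearOperad S) x i y) ≋
      Operad._∘[_]_ (linearOperad T) (linear f x) i (linear f y)
    go (η s)    (η t)    rewrite f-∘ s i t = ≋-refl
    go (η s)    𝟘        = ≋-refl
    go (η s)    (y ⊕ y′) = ⊕-cong (go (η s) y) (go (η s) y′)
    go (η s)    (k · y)  = ·-cong 𝕂.refl (go (η s) y)
    go 𝟘        y        = ≋-refl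
    go (x ⊕ x′) y        = ⊕-cong (go x y) (go x′ y)
    go (k · x)  y        = ·-cong 𝕂.refl (go x y)

-- Congruence of trees modulo the relations.

module Presentation (𝕂 : HeytingField c ℓ₁ ℓ₂) (γ : ℕ) where

  open LinearOperads 𝕂 hiding (_∼_; ≈⇒∼)
  open LinearMaps 𝕂
  open Trees (Generator γ) using (TreeOf; TreeOf-≡; leaves; leaves*; graft; corolla)
  open Max (Fin.≤-totalOrder γ) using (_⊔_; x≤y⇒x⊔y≈y; x≤y⇒y⊔x≈y)

  private
    module F = Operad (Free (Generator γ))
    module T = Operad (TM 𝕂 γ)
    module 𝕂 = CommutativeRing (fieldRing 𝕂)
    module D = Operad (Dias 𝕂 γ)

  relationIdeal : Ideal (Free (Generator γ)) _
  relationIdeal = generatedIdeal (Free (Generator γ)) (DiasRelations 𝕂 γ)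

  Quotient : Operad _ _
  Quotient = quotient relationIdeal

  private
    module Q = Operad Quotient
    module QS {n} = Module (Q.space n)

  infix 4 _∼_ _≈_

  _∼_ : ∀ {n} → F.El n → F.El n → Set _
  _∼_ = Q.Space._≈ᴹ_

  -- Congruence modulo the ideal, for trees whose arity is not part of the type.
  record _≈_ (s t : Tree (Generator γ)) : Set (c Level.⊔ ℓ₁) where
    constructor congruent
    field
      {arity} : ℕ
      sˡ      : leaves s ≡ suc arity
      tˡ      : leaves t ≡ suc arity
      s∼t     : η (s , sˡ) ∼ η (t , tˡ)

  ∼⇒≈ : ∀ {n} {s t : TreeOf n} → η s ∼ η t → proj₁ s ≈ proj₁ t
  ∼⇒≈ {s = s} {t} = congruent (proj₂ s) (proj₂ t)

  -- The arity stored in the congruence is forced by the leaf count of `s`, and proofs of leaf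
  -- counts are unique, so the congruence moves to any given `p`.
  ≈⇒∼ : ∀ {n} {s t : Tree (Generator γ)} (p : leaves s ≡ suc n) → s ≈ t →
    Σ[ q ∈ leaves t ≡ suc n ] η (s , p) ∼ η (t , q)
  ≈⇒∼ p (congruent p′ q′ r) with suc-injective (trans (sym p) p′)
  ... | refl = q′ , QS.≈ᴹ-trans (QS.≈ᴹ-reflexive (cong η (TreeOf-≡ refl))) r

  positive-leaves : ∀ t → ∃[ n ] (leaves t ≡ suc n)
  positive-leaves leaf              = 0 , refl
  positive-leaves (node x (t ∷ ts)) with positive-leaves t
  ... | n , e = n + leaves* ts , cong (_+ leaves* ts) e

  ≈-refl : ∀ {t} → t ≈ t
  ≈-refl {t} = congruent (proj₂ (positive-leaves t)) _ QS.≈ᴹ-refl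

  ≈-sym : ∀ {s t} → s ≈ t → t ≈ s
  ≈-sym (congruent p q r) = congruent q p (QS.≈ᴹ-sym r)

  ≈-trans : ∀ {s t r} → s ≈ t → t ≈ r → s ≈ r
  ≈-trans (congruent p q s∼t) t≈r with ≈⇒∼ q t≈r
  ... | q′ , t∼r = congruent p q′ (QS.≈ᴹ-trans s∼t t∼r)

  -- Filling the right input first keeps both positions literal, so the underlying tree computes to
  -- `node x (s ∷ t ∷ [])`. `plug` fills its inputs from right to left for the same reason.
  fork : Generator γ 1 → ∀ {n m} → TreeOf n → TreeOf m → TreeOf (1 + m + n)
  fork x s t = Trees._∘[_]_ _ (Trees._∘[_]_ _ (corolla x) (suc zero) t) zero s

  fork-cong : ∀ (x : Generator γ 1) {s s′ t t′} → s ≈ s′ → t ≈ t′ →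
    node x (s ∷ t ∷ []) ≈ node x (s′ ∷ t′ ∷ [])
  fork-cong x {s} {s′} {t} {t′} (congruent p p′ s∼s′) (congruent q q′ t∼t′) =
    ∼⇒≈ {s = fork x (s , p) (t , q)} {fork x (s′ , p′) (t′ , q′)}
      (Q.∘-cong {x = η (Trees._∘[_]_ _ (corolla x) (suc zero) (t , q))}
                {η (Trees._∘[_]_ _ (corolla x) (suc zero) (t′ , q′))}
                zero {η (s , p)} {η (s′ , p′)}
        (Q.∘-cong {x = η (corolla x)} {η (corolla x)} (suc zero) {η (t , q)} {η (t′ , q′)}
          QS.≈ᴹ-refl t∼t′)
        s∼s′)

  plug : ∀ {n m l} → TreeOf 2 → TreeOf n → TreeOf m → TreeOf l → TreeOf (2 + l + m + n)
  plug t x y z = Trees._∘[_]_ _ (Trees._∘[_]_ _ (Trees._∘[_]_ _ t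
    (suc (suc zero)) z) (suc zero) y) zero x

  relation : {s t : TreeOf 2} → s ↔γ t → ∀ {n m l} (x : TreeOf n) (y : TreeOf m) (z : TreeOf l) →
    η (plug s x y z) ∼ η (plug t x y z)
  relation {s} {t} s↔t x y z =
    Q.∘-cong {x = η _} {η _} zero {η x} {η x}
      (Q.∘-cong {x = η _} {η _} (suc zero) {η y} {η y}
        (Q.∘-cong {x = η s} {η t} (suc (suc zero)) {η z} {η z}
          (gen (gen (s , t , s↔t , refl))) QS.≈ᴹ-refl)
        QS.≈ᴹ-refl)
      QS.≈ᴹ-refl

  relation-≈ : {s t : TreeOf 2} → s ⇿ t → ∀ x y z →
    graft (graft (graft (proj₁ s) 2 z) 1 y) 0 x ≈ graft (graft (graft (proj₁ t) 2 z) 1 y) 0 x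
  relation-≈ {s} {t} s⇿t x y z =
    ∼⇒≈ {s = plug s x′ y′ z′} {plug t x′ y′ z′} (relation (EqClosure.return s⇿t) x′ y′ z′)
    where
    x′ : TreeOf _
    x′ = x , proj₂ (positive-leaves x)
    y′ : TreeOf _
    y′ = y , proj₂ (positive-leaves y)
    z′ : TreeOf _
    z′ = z , proj₂ (positive-leaves z)

  -- The five identities.

  ⊢⊣-assoc : ∀ a b x y z → (x ⊢[ b ] y) ⊣[ a ] z ≈ x ⊢[ b ] (y ⊣[ a ] z)
  ⊢⊣-assoc a b = relation-≈ (⊣⊢ a b)

  -- The strict and the weak relations are two cases of one identity: for `a < b` the maximum is
  -- `b`, otherwise it is `a` and the weak relations apply with `c = b` and `d = a`. The next three
  -- identities split in the same way.
  ⊣⊢-assocʳ : ∀ a b x y z → x ⊣[ a ] (y ⊢[ b ] z) ≈ (x ⊣[ a ⊔ b ] y) ⊣[ a ] z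
  ⊣⊢-assocʳ a b x y z with a Fin.<? b
  ... | yes a<b rewrite x≤y⇒x⊔y≈y (<⇒≤ a<b) = ≈-sym (relation-≈ (⊣<₁ a<b) x y z)
  ... | no  a≮b rewrite x≤y⇒y⊔x≈y (≮⇒≥ a≮b) = ≈-sym
    (≈-trans (relation-≈ (⊣≤₁ (≮⇒≥ a≮b)) x y z) (relation-≈ (⊣≤₂ (≮⇒≥ a≮b)) x y z))

  ⊣⊣-assoc : ∀ a b x y z → x ⊣[ a ] (y ⊣[ b ] z) ≈ (x ⊣[ a ] y) ⊣[ a ⊔ b ] z
  ⊣⊣-assoc a b x y z with a Fin.<? b
  ... | yes a<b rewrite x≤y⇒x⊔y≈y (<⇒≤ a<b) = ≈-sym (relation-≈ (⊣<₂ a<b) x y z)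
  ... | no  a≮b rewrite x≤y⇒y⊔x≈y (≮⇒≥ a≮b) = ≈-sym (relation-≈ (⊣≤₁ (≮⇒≥ a≮b)) x y z)

  ⊣⊢-assocˡ : ∀ a b x y z → (x ⊣[ b ] y) ⊢[ a ] z ≈ x ⊢[ a ] (y ⊢[ a ⊔ b ] z)
  ⊣⊢-assocˡ a b x y z with a Fin.<? b
  ... | yes a<b rewrite x≤y⇒x⊔y≈y (<⇒≤ a<b) = relation-≈ (⊢<₁ a<b) x y z
  ... | no  a≮b rewrite x≤y⇒y⊔x≈y (≮⇒≥ a≮b) =
    ≈-trans (relation-≈ (⊢≤₁ (≮⇒≥ a≮b)) x y z) (relation-≈ (⊢≤₂ (≮⇒≥ a≮b)) x y z)

  ⊢⊢-assoc : ∀ a b x y z → (x ⊢[ b ] y) ⊢[ a ] z ≈ x ⊢[ a ⊔ b ] (y ⊢[ a ] z)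
  ⊢⊢-assoc a b x y z with a Fin.<? b
  ... | yes a<b rewrite x≤y⇒x⊔y≈y (<⇒≤ a<b) = relation-≈ (⊢<₂ a<b) x y z
  ... | no  a≮b rewrite x≤y⇒y⊔x≈y (≮⇒≥ a≮b) = relation-≈ (⊢≤₂ (≮⇒≥ a≮b)) x y z

  ⊣-cong : ∀ a {s s′ t t′} → s ≈ s′ → t ≈ t′ → s ⊣[ a ] t ≈ s′ ⊣[ a ] t′
  ⊣-cong a = fork-cong (⊣ a)

  ⊢-cong : ∀ a {s s′ t t′} → s ≈ s′ → t ≈ t′ → s ⊢[ a ] t ≈ s′ ⊢[ a ] t′
  ⊢-cong a = fork-cong (⊢ a)

  -- Rewriting trees to combs.

  rights-cong : ∀ {s t} v → s ≈ t → rights s v ≈ rights t v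
  rights-cong []      s≈t = s≈t
  rights-cong (a ∷ v) s≈t = rights-cong v (⊣-cong a s≈t ≈-refl)

  lefts-cong : ∀ u {s t} → s ≈ t → lefts u s ≈ lefts u t
  lefts-cong []      s≈t = s≈t
  lefts-cong (a ∷ u) s≈t = ⊢-cong a ≈-refl (lefts-cong u s≈t)

  lefts-⊣ : ∀ u a s t → lefts u s ⊣[ a ] t ≈ lefts u (s ⊣[ a ] t)
  lefts-⊣ []      a s t = ≈-refl
  lefts-⊣ (b ∷ u) a s t =
    ≈-trans (⊢⊣-assoc a b leaf (lefts u s) t) (⊢-cong b ≈-refl (lefts-⊣ u a s t))

  rights-lefts : ∀ u t v → rights (lefts u t) v ≈ lefts u (rights t v)
  rights-lefts u t []      = ≈-refl
  rights-lefts u t (a ∷ v) =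
    ≈-trans (rights-cong v (lefts-⊣ u a t leaf)) (rights-lefts u (t ⊣[ a ] leaf) v)

  -- Each use of `⊣⊢-assocʳ` moves one left leaf across the root and raises its label; the root
  -- keeps the label `a`, so the step repeats.
  ⊣-lefts : ∀ a s u t → s ⊣[ a ] lefts u t ≈ rights s (List.map (a ⊔_) u) ⊣[ a ] t
  ⊣-lefts a s []      t = ≈-refl
  ⊣-lefts a s (b ∷ u) t =
    ≈-trans (⊣⊢-assocʳ a b s leaf (lefts u t)) (⊣-lefts a (s ⊣[ a ⊔ b ] leaf) u t)

  -- The first label of a left fold is innermost: its leaf is absorbed into `t` for the induction
  -- and split off afterwards, beneath the other leaves.
  ⊣-rights : ∀ a s t v → s ⊣[ a ] rights t v ≈ rights (s ⊣[ a ] t) (List.map (a ⊔_) v)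
  ⊣-rights a s t []      = ≈-refl
  ⊣-rights a s t (b ∷ v) = ≈-trans (⊣-rights a s (t ⊣[ b ] leaf) v)
    (rights-cong (List.map (a ⊔_) v) (⊣⊣-assoc a b s t leaf))

  lefts-⊢ : ∀ a u s t → lefts u s ⊢[ a ] t ≈ lefts (List.map (a ⊔_) u) (s ⊢[ a ] t)
  lefts-⊢ a []      s t = ≈-refl
  lefts-⊢ a (b ∷ u) s t =
    ≈-trans (⊢⊢-assoc a b leaf (lefts u s) t) (⊢-cong (a ⊔ b) ≈-refl (lefts-⊢ a u s t))

  -- The leaf nearest to `s` crosses the root last and ends up outermost, so the order of the labels
  -- is preserved.
  rights-⊢ : ∀ a s v t → rights s v ⊢[ a ] t ≈ s ⊢[ a ] lefts (List.map (a ⊔_) v) t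
  rights-⊢ a s []      t = ≈-refl
  rights-⊢ a s (b ∷ v) t = ≈-trans (rights-⊢ a (s ⊣[ b ] leaf) v t)
    (⊣⊢-assocˡ a b s leaf (lefts (List.map (a ⊔_) v) t))

  -- The central leaf of the right comb becomes a right leaf labelled by the root's `a`, just as its
  -- zero is raised to `a`. The left leaves `u` are then moved back outside by `rights-lefts`.
  comb-⊣ : ∀ a u v u′ v′ → comb u v ⊣[ a ] comb u′ v′ ≈
    comb u (v ++ List.map (a ⊔_) u′ ++ a ∷ List.map (a ⊔_) v′)
  comb-⊣ a u v u′ v′ = ≈-trans (⊣-lefts a (comb u v) u′ (rights leaf v′))
    (≈-trans (⊣-rights a _ leaf v′) (≈-trans split
      (≈-trans (rights-lefts u (rights leaf v) w) join)))
    where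
    w : List (Fin γ)
    w = List.map (a ⊔_) u′ ++ a ∷ List.map (a ⊔_) v′
    split : rights (rights (comb u v) (List.map (a ⊔_) u′)) (a ∷ List.map (a ⊔_) v′) ≈
            rights (comb u v) w
    split rewrite List.foldl-++ (_⊣[_] leaf) (comb u v) (List.map (a ⊔_) u′)
                    (a ∷ List.map (a ⊔_) v′) = ≈-refl
    join : lefts u (rights (rights leaf v) w) ≈ comb u (v ++ w)
    join rewrite List.foldl-++ (_⊣[_] leaf) leaf v w = ≈-refl

  comb-⊢ : ∀ a u v u′ v′ → comb u v ⊢[ a ] comb u′ v′ ≈
    comb ((List.map (a ⊔_) u ++ a ∷ List.map (a ⊔_) v) ++ u′) v′
  comb-⊢ a u v u′ v′ = ≈-trans (lefts-⊢ a u (rights leaf v) (comb u′ v′))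
    (≈-trans (lefts-cong (List.map (a ⊔_) u) (rights-⊢ a leaf v (comb u′ v′)))
      (≈-trans join join′))
    where
    w : List (Fin γ)
    w = List.map (a ⊔_) u ++ a ∷ List.map (a ⊔_) v
    join : lefts (List.map (a ⊔_) u) (lefts (a ∷ List.map (a ⊔_) v) (comb u′ v′)) ≈
           lefts w (comb u′ v′)
    join rewrite List.foldr-++ (leaf ⊢[_]_) (comb u′ v′) (List.map (a ⊔_) u)
                   (a ∷ List.map (a ⊔_) v) = ≈-refl
    join′ : lefts w (comb u′ v′) ≈ comb (w ++ u′) v′
    join′ rewrite List.foldr-++ (leaf ⊢[_]_) (rights leaf v′) w u′ = ≈-refl

  -- Word and comb share the same `u` and `v`, so the evaluation of a tree determines its congruence
  -- class.
  normalForm : ∀ t → ∃₂ λ u v → eval t ≡ letters u v × t ≈ comb u v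
  normalForm leaf = [] , [] , refl , ≈-refl
  normalForm (node (⊣ a) (s ∷ t ∷ [])) with normalForm s | normalForm t
  ... | u , v , e , s≈ | u′ , v′ , e′ , t≈ = _ , _ ,
    trans (cong₂ (λ w w′ → List.map _ w ++ List.map _ w′ ++ []) e e′) (letters-⊣ a u v u′ v′) ,
    ≈-trans (⊣-cong a s≈ t≈) (comb-⊣ a u v u′ v′)
  normalForm (node (⊢ a) (s ∷ t ∷ [])) with normalForm s | normalForm t
  ... | u , v , e , s≈ | u′ , v′ , e′ , t≈ = _ , _ ,
    trans (cong₂ (λ w w′ → List.map _ w ++ List.map _ w′ ++ []) e e′) (letters-⊢ a u v u′ v′) ,
    ≈-trans (⊢-cong a s≈ t≈) (comb-⊢ a u v u′ v′)

  -- Words without exactly one 0 go to 𝟘, since for γ = 0 there are no trees to send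
  -- them to; the arity test never fails on a comb read off a word of length suc n.
  fromTree : ∀ {n} → Maybe (Tree (Generator γ)) → F.El n
  fromTree         nothing  = 𝟘
  fromTree {n = n} (just t) with leaves t ≟ suc n
  ... | yes e = η (t , e)
  ... | no  _ = 𝟘

  fromTree-just : ∀ {n} (t : TreeOf n) → fromTree (just (proj₁ t)) ≡ η t
  fromTree-just {n} (t , e) with leaves t ≟ suc n
  ... | yes _ = cong η (TreeOf-≡ refl)
  ... | no ¬e = contradiction e ¬e

  -- The maps `φ` and `ψ` between trees and words.

  φ : ∀ {n} → F.El n → T.El n
  φ = linear evaluate

  -- Defined on all of `TM`, where the words form a basis; it inverts `φ` on `Dias` by `φ∘ψ`.
  ψ : ∀ {n} → T.El n → F.El n
  ψ = extend (F.space _) (fromTree ∘ readComb ∘ Vec.toList)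

  ψ-cong : ∀ {n} {x y : T.El n} → x ≋ y → ψ x ∼ ψ y
  ψ-cong {n} {x} {y} x≋y = LinearOperads.≈⇒∼ 𝕂 (Ideal.subspaces relationIdeal n) {ψ x} {ψ y}
    (extend-cong (F.space n) _ x≋y)

  -- On a tree, `readComb` recovers the normal form from the evaluation, and the tree is congruent
  -- to its normal form.
  ψ∘φ : ∀ {n} (x : F.El n) → ψ (φ x) ∼ x
  ψ∘φ (η t) with normalForm (proj₁ t)
  ... | u , v , e , t≈ with ≈⇒∼ (proj₂ t) t≈
  ... | q , t∼ = QS.≈ᴹ-trans (QS.≈ᴹ-reflexive (trans
    (cong fromTree (trans (cong readComb (trans (toList-evaluate t) e)) (readComb-letters u v)))
    (fromTree-just (comb u v , q)))) (QS.≈ᴹ-sym t∼)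
  ψ∘φ 𝟘       = QS.≈ᴹ-refl
  ψ∘φ (x ⊕ y) = QS.+ᴹ-cong (ψ∘φ x) (ψ∘φ y)
  ψ∘φ (k · x) = QS.*ₗ-cong 𝕂.refl (ψ∘φ x)

  φ-∘ : ∀ {n m} (x : F.El n) i (y : F.El m) → φ (x F.∘[ i ] y) ≋ φ x T.∘[ i ] φ y
  φ-∘ = linear-∘ (Trees.treeOperad (Generator γ)) (wordOperad (maxIsMonoid γ)) evaluate evaluate-∘

  φ-relations : ∀ {n x} → Subspace._∈ (DiasRelations 𝕂 γ n) x → φ x ≋ 𝟘
  φ-relations {n} (gen (s , t , s↔t , refl)) =
    ≋-trans (⊕-cong ≋-refl (·-cong 𝕂.refl (TS.≈ᴹ-reflexive (cong η (sym (evaluate-↔ s↔t))))))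
      (TS.-ᴹ‿inverseʳ (η (evaluate s)))
    where
    module TS = Module (T.space n)
    evaluate-↔ : ∀ {s t : TreeOf n} → s ↔γ t → evaluate s ≡ evaluate t
    evaluate-↔ = EqClosure.gfold isEquivalence evaluate λ {s} {t} s⇿t →
      evaluate-≡ s _ (trans (eval-⇿ s⇿t) (sym (toList-evaluate t)))
  φ-relations (resp x≋y x∈)   = ≋-trans (≋-sym (extend-cong (T.space _) _ x≋y)) (φ-relations x∈)
  φ-relations zer             = ≋-refl
  φ-relations (add x∈ y∈)     = ≋-trans (⊕-cong (φ-relations x∈) (φ-relations y∈)) (⊕-identityˡ 𝟘)
  φ-relations {n} (mul k x∈)  =
    ≋-trans (·-cong 𝕂.refl (φ-relations x∈)) (Module.*ₗ-zeroʳ (T.space n) k)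

  -- Composition computes on its left factor only, so `𝟘` on the right is rewritten as `0# · 𝟘` and
  -- the scalar is pulled out.
  ∘-zeroʳ : ∀ {n m} (x : T.El n) i → x T.∘[ i ] 𝟘 {B = Vec (Fin (suc γ)) (suc m)} ≋ 𝟘
  ∘-zeroʳ x i = ≋-trans (T.∘-cong {x = x} i ≋-refl (≋-sym (·-zeroˡ 𝟘)))
    (≋-trans (T.∘-*ʳ 𝕂.0# x i 𝟘) (·-zeroˡ _))

  φ-ideal : ∀ {n x} → InIdeal (Free (Generator γ)) (λ n → Subspace._∈ (DiasRelations 𝕂 γ n)) n x →
    φ x ≋ 𝟘
  φ-ideal (gen x∈)      = φ-relations x∈
  φ-ideal (resp x≋y x∈) = ≋-trans (≋-sym (extend-cong (T.space _) _ x≋y)) (φ-ideal x∈)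
  φ-ideal zer           = ≋-refl
  φ-ideal (add x∈ y∈)   = ≋-trans (⊕-cong (φ-ideal x∈) (φ-ideal y∈)) (⊕-identityˡ 𝟘)
  φ-ideal {n} (mul k x∈) =
    ≋-trans (·-cong 𝕂.refl (φ-ideal x∈)) (Module.*ₗ-zeroʳ (T.space n) k)
  φ-ideal (compˡ {x = x} i y x∈) =
    ≋-trans (φ-∘ x i y) (T.∘-cong {x = φ x} {𝟘} i (φ-ideal x∈) (≋-refl {x = φ y}))
  φ-ideal (compʳ x i {y} y∈) = ≋-trans (φ-∘ x i y)
    (≋-trans (T.∘-cong {x = φ x} i ≋-refl (φ-ideal y∈)) (∘-zeroʳ (φ x) i))

  φ-cong : ∀ {n} {x y : F.El n} → x ∼ y → φ x ≋ φ y
  φ-cong {n} {x} {y} x∼y =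
    x∙y⁻¹≈ε⇒x≈y (φ x) (φ y) (φ-ideal x∼y)
    where open import Algebra.Properties.Group (Module.+ᴹ-group (T.space n)) using (x∙y⁻¹≈ε⇒x≈y)

  -- The image of `φ` is `Dias`.

  InDias : ∀ {n} → T.El n → Set _
  InDias {n} = InSuboperad (TM 𝕂 γ) (DiasWord 𝕂 γ) n

  φ-tree : ∀ t {n} (p : leaves t ≡ suc n) → InDias (η (evaluate (t , p)))
  φ-tree leaf refl = one
  -- All generators are binary, so the tree is a `fork`: two compositions starting from a generating
  -- word.
  φ-tree (node {1} x (s ∷ t ∷ [])) p with positive-leaves s | positive-leaves t
  ... | _ , q | _ , r with suc-injective (trans (sym (proj₂ (fork x (s , q) (t , r)))) p)
  ... | refl = resp (Module.≈ᴹ-reflexive (T.space _) (cong η (sym evaluate-fork)))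
      (comp zero (comp (suc zero) (gen (isDiasWord x)) (φ-tree t r)) (φ-tree s q))
    where
    isDiasWord : ∀ x → DiasWord 𝕂 γ 1 (η (generatorWord x))
    isDiasWord (⊣ a) = 0a a
    isDiasWord (⊢ a) = a0 a
    evaluate-fork : evaluate (node x (s ∷ t ∷ []) , p) ≡ Words._∘[_]_ _
      (Words._∘[_]_ _ (generatorWord x) (suc zero) (evaluate (t , r))) zero (evaluate (s , q))
    evaluate-fork = trans (cong evaluate (TreeOf-≡ {t = node x (s ∷ t ∷ []) , p} {fork x (s , q) (t , r)} refl))
      (trans (evaluate-∘ (Trees._∘[_]_ _ (corolla x) (suc zero) (t , r)) zero (s , q))
        (cong (λ w → Words._∘[_]_ _ w zero (evaluate (s , q)))
          (trans (evaluate-∘ (corolla x) (suc zero) (t , r))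
            (cong (λ w → Words._∘[_]_ _ w (suc zero) (evaluate (t , r))) (evaluate-corolla x)))))

  φ-Dias : ∀ {n} (x : F.El n) → InDias (φ x)
  φ-Dias (η (t , p)) = φ-tree t p
  φ-Dias 𝟘       = zer
  φ-Dias (x ⊕ y) = add (φ-Dias x) (φ-Dias y)
  φ-Dias (k · x) = mul k (φ-Dias x)

  -- The image of `φ` contains the generating words and is closed under all operations of a
  -- suboperad.
  Dias-φ : ∀ {n} {x : T.El n} → InDias x → Σ[ y ∈ F.El n ] φ y ≋ x
  Dias-φ (gen (0a a)) = η (corolla (⊣ a)) , Module.≈ᴹ-reflexive (T.space 1)
    (cong η (evaluate-corolla (⊣ a)))
  Dias-φ (gen (a0 a)) = η (corolla (⊢ a)) , Module.≈ᴹ-reflexive (T.space 1)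
    (cong η (evaluate-corolla (⊢ a)))
  Dias-φ (resp x≋y x∈) = proj₁ (Dias-φ x∈) , ≋-trans (proj₂ (Dias-φ x∈)) x≋y
  Dias-φ zer = 𝟘 , ≋-refl
  Dias-φ (add x∈ y∈) = proj₁ (Dias-φ x∈) ⊕ proj₁ (Dias-φ y∈) ,
    ⊕-cong (proj₂ (Dias-φ x∈)) (proj₂ (Dias-φ y∈))
  Dias-φ (mul k x∈) = k · proj₁ (Dias-φ x∈) , ·-cong 𝕂.refl (proj₂ (Dias-φ x∈))
  Dias-φ one = F.unit , ≋-refl
  Dias-φ (comp i x∈ y∈) = proj₁ (Dias-φ x∈) F.∘[ i ] proj₁ (Dias-φ y∈) ,
    ≋-trans (φ-∘ (proj₁ (Dias-φ x∈)) i (proj₁ (Dias-φ y∈)))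
      (T.∘-cong i (proj₂ (Dias-φ x∈)) (proj₂ (Dias-φ y∈)))

  -- The isomorphism.

  -- Any preimage under `φ` computes `ψ` modulo the ideal. This gives surjectivity and compatibility
  -- with composition.
  ψ∘φ-≋ : ∀ {n} (x : F.El n) {y : T.El n} → φ x ≋ y → ψ y ∼ x
  ψ∘φ-≋ x e = QS.≈ᴹ-trans (QS.≈ᴹ-sym (ψ-cong e)) (ψ∘φ x)

  -- Membership in `Dias` supplies a preimage `y` of `x`; then `ψ x ∼ y`, and `φ` is constant on
  -- congruence classes.
  φ∘ψ : ∀ {n} {x : T.El n} → InDias x → φ (ψ x) ≋ x
  φ∘ψ x∈ with Dias-φ x∈
  ... | y , e = ≋-trans (φ-cong (ψ∘φ-≋ y e)) e

  isPresentation : IsPresentation (Dias 𝕂 γ) (Generator γ) (DiasRelations 𝕂 γ)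
  isPresentation = record
    { ⟦_⟧ = λ (x , _) → ψ x
    ; isModuleIsomorphism = λ n → record
      { isModuleMonomorphism = record
        { isModuleHomomorphism = record
          { isBimoduleHomomorphism = record
            { +ᴹ-isGroupHomomorphism = record
              { isMonoidHomomorphism = record
                { isMagmaHomomorphism = record
                  { isRelHomomorphism = record { cong = ψ-cong }
                  ; homo = λ _ _ → QS.≈ᴹ-refl
                  }
                ; ε-homo = QS.≈ᴹ-refl
                }
              ; ⁻¹-homo = λ _ → QS.≈ᴹ-refl
              }
            ; *ₗ-homo = λ _ _ → QS.≈ᴹ-refl
            ; *ᵣ-homo = λ _ _ → QS.≈ᴹ-refl
            }
          }
        ; injective = λ {(x , x∈)} {(y , y∈)} e →
            ≋-trans (≋-sym (φ∘ψ x∈)) (≋-trans (φ-cong e) (φ∘ψ y∈))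
        }
      ; surjective = λ y → (φ y , φ-Dias y) , λ e → ψ∘φ-≋ y (≋-sym e)
      }
    -- `φ F.unit` computes to the one-letter word 0, the unit of `TM`.
    ; unit-homo = ψ∘φ F.unit
    ; ∘-homo = ∘-homo
    }
    where
    ∘-homo : ∀ {n m} (x : D.El n) i (y : D.El m) →
      ψ (proj₁ x T.∘[ i ] proj₁ y) ∼ ψ (proj₁ x) F.∘[ i ] ψ (proj₁ y)
    -- `ψ x ∘ ψ y` is a preimage of `x ∘ y`, since `φ` preserves composition and undoes `ψ` on
    -- `Dias`.
    ∘-homo (x , x∈) i (y , y∈) = ψ∘φ-≋ (ψ x F.∘[ i ] ψ y) (≋-trans (φ-∘ (ψ x) i (ψ y))
      (T.∘-cong i (φ∘ψ x∈) (φ∘ψ y∈)))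

theorem2p2p6 : ∀ {c ℓ₁ ℓ₂} (𝕂 : HeytingField c ℓ₁ ℓ₂) → CharacteristicZero 𝕂 → (γ : ℕ) →
    LinearOperads.IsPresentation 𝕂 (Dias 𝕂 γ) (Generator γ) (DiasRelations 𝕂 γ)
theorem2p2p6 𝕂 _ γ = Presentation.isPresentation 𝕂 γ
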